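{- Let $m\ge 3$ be an integer, let $D\subset\{0,1,\dots,m-1\}$ with $1<\#D<m$, and let $K_{m,D}$ be the associated missing-digit set. For a sequence $\{a_n\}_{n\ge 1}$ of positive integers, define $Q_n:=\frac{a_n}{(a_n,m^\infty)}$. Fix a prime $p_0\nmid m$, and let $t=t(m,p_0)$ and $c_{m,D}$ be as defined in the context. Suppose there exist functions $\alpha,\gamma:\mathbb{N}\to\mathbb{R}$ and an index $N\in\mathbb{N}$ such that for every $n\ge N$, $$\nu_{p_0}(Q_n)\ge\alpha(n),\qquad \nu_{p_0}\bigl(\operatorname{ord}_{\operatorname{rad}(Q_n)}(m)\bigr)\le\gamma(n),$$ and moreover there exists $n_0\ge N$ such that for all $n\ge n_0$, $$\alpha(n)>t+\gamma(n)+\log_{p_0}(c_{m,D}).$$ Then $\frac{1}{a_n}\notin K_{m,D}$ for all $n\ge n_0$. In particular, the intersection $\left\{\frac{1}{a_n}:n\in\mathbb{N}\right\}\cap K_{m,D}$ is finite.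
   Context: $\mathbb{N}=\{1,2,3,\dots\}$. The missing-digit set is $K_{m,D}:=\left\{\sum_{j=1}^\infty \frac{b_j}{m^j}: b_j\in D\text{ for all }j\ge 1\right\}\subset[0,1]$. For a prime $p$, $\nu_p$ denotes the $p$-adic valuation. For a positive integer $A$, $(A,m^\infty):=\prod_{p\mid m}p^{\nu_p(A)}$ (product over primes $p$ dividing $m$) is the full $m$-part of $A$. For integers $u,q\ge 1$ with $\gcd(u,q)=1$, $\operatorname{ord}_q(u)$ is the multiplicative order of $u$ modulo $q$, with $\operatorname{ord}_1(u)=1$; $\operatorname{rad}(q)$ is the radical of $q$ (with $\operatorname{rad}(1)=1$). The constant is $$c_{m,D}:=2(m-1)\min\left\{1,\frac{\#D}{m-\#D}\right\}.$$ For a prime $p_0\nmid m$, the overhead parameter is $t(m,p_0):=\nu_{p_0}\bigl(m^{\operatorname{ord}_{p_0}(m)}-1\bigr)$ if $p_0$ is odd, and $t(m,2):=\nu_2(m^2-1)-1$ if $p_0=2$. -}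

module Defs where

open import Level using (0ℓ)
open import Data.Empty using (⊥; ⊥-elim)
open import Data.Nat as ℕ using (ℕ; zero; suc; z≤n; s≤s; NonZero; NonTrivial)
open import Data.Nat.Divisibility using (_∣_; _∣?_)
open import Data.Nat.Primality using (Prime; prime?; prime⇒nonZero)
open import Data.Nat.ListAction using (product)
open import Data.Nat.ListAction.Properties using (product≢0)
import Data.Nat.Properties as ℕₚ
import Data.Nat.Tactic.RingSolver as ℕ-Solver
open import Data.Integer as ℤ using (ℤ; +_; -[1+_])
import Data.Integer.Properties as ℤₚ
import Data.Integer.Tactic.RingSolver as ℤ-Solver
open import Data.Rational as ℚ using (ℚ; mkℚ; 0ℚ; 1ℚ; ½; ↥_; ↧_; ↧ₙ_; toℚᵘ)
import Data.Rational.Properties as ℚₚ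
open import Data.Rational.Unnormalised as ℚᵘ using (mkℚᵘ; *≡*; *<*)
import Data.Rational.Unnormalised.Properties as ℚᵘₚ
open import Algebra.Definitions.RawSemiring ℚ.+-*-rawSemiring using () renaming (_^_ to _^ℚ_) public
open import Data.Fin using (Fin; toℕ)
open import Data.Fin.Properties using (nonZeroIndex)
import Data.Fin.Subset as Subset
open Subset using (Subset)
open import Data.List using (List; map; filter; upTo)
open import Data.List.Extrema.Nat using (max; min)
open import Data.List.Relation.Unary.All as All using (All)
open import Data.List.Relation.Unary.All.Properties using (all-filter; map⁺)
open import Data.List.Relation.Unary.Any using (Any)
open import Data.Product using (Σ-syntax; ∃-syntax; _×_; _,_; proj₁; proj₂)
open import Data.Sum using (inj₁; inj₂)
open import Function using (_⇔_)
open import Relation.Nullary using (yes; no)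
open import Relation.Nullary.Decidable using (_×-dec_)
open import Relation.Unary using (Pred)
open import Relation.Binary.PropositionalEquality

record ℕ⁺ : Set where
  constructor mkℕ⁺
  field
    value         : ℕ
    .{{positive}} : NonZero value

open ℕ⁺ public using (value)

infix 4 _≤⁺_

_≤⁺_ : ℕ⁺ → ℕ⁺ → Set
m ≤⁺ n = value m ℕ.≤ value n

-- Dedekind cuts of ℚ.  `located` is the form of locatedness that provides
-- rational approximations of any precision; it also makes both halves
-- inhabited.

record ℝ : Set₁ where
  field
    L U        : ℚ → Set
    L-down     : ∀ {q r} → q ℚ.< r → L r → L q
    L-open     : ∀ {q} → L q → ∃[ r ] (q ℚ.< r × L r)
    U-up       : ∀ {q r} → q ℚ.< r → U q → U r
    U-open     : ∀ {r} → U r → ∃[ q ] (q ℚ.< r × U q)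
    L<U        : ∀ {q r} → L q → U r → q ℚ.< r
    located    : ∀ ε → 0ℚ ℚ.< ε → ∃[ q ] (L q × U (q ℚ.+ ε))

open ℝ public

infix 4 _<ᵣ_ _≤ᵣ_ _≈ᵣ_

_<ᵣ_ _≤ᵣ_ _≈ᵣ_ : ℝ → ℝ → Set
x <ᵣ y = ∃[ q ] (U x q × L y q)
x ≤ᵣ y = ∀ q → L x q → L y q
x ≈ᵣ y = x ≤ᵣ y × y ≤ᵣ x

private
  halves : ∀ ε → ½ ℚ.* ε ℚ.+ ½ ℚ.* ε ≡ ε
  halves ε = trans (sym (ℚₚ.*-distribʳ-+ ε ½ ½)) (ℚₚ.*-identityˡ ε)

  half>0 : ∀ {ε} → 0ℚ ℚ.< ε → 0ℚ ℚ.< ½ ℚ.* ε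
  half>0 {ε} 0<ε = ℚₚ.positive⁻¹ (½ ℚ.* ε) {{ℚₚ.pos*pos⇒pos ½ ε {{ℚ.positive 0<ε}}}}

  p<p+ε : ∀ p {ε} → 0ℚ ℚ.< ε → p ℚ.< p ℚ.+ ε
  p<p+ε p {ε} 0<ε = subst (ℚ._< p ℚ.+ ε) (ℚₚ.+-identityʳ p) (ℚₚ.+-monoʳ-< p 0<ε)

  p-q+q≡p : ∀ p q → (p ℚ.- q) ℚ.+ q ≡ p
  p-q+q≡p p q = trans (ℚₚ.+-assoc p (ℚ.- q) q)
    (trans (cong (p ℚ.+_) (ℚₚ.+-inverseˡ q)) (ℚₚ.+-identityʳ p))

  p+q-q≡p : ∀ p q → (p ℚ.+ q) ℚ.- q ≡ p
  p+q-q≡p p q = trans (ℚₚ.+-assoc p q (ℚ.- q))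
    (trans (cong (p ℚ.+_) (ℚₚ.+-inverseʳ q)) (ℚₚ.+-identityʳ p))

  <+⇒-< : ∀ {z q r} → z ℚ.< q ℚ.+ r → z ℚ.- r ℚ.< q
  <+⇒-< {z} {q} {r} z< = subst (z ℚ.- r ℚ.<_) (p+q-q≡p q r) (ℚₚ.+-monoˡ-< (ℚ.- r) z<)

  +<⇒<- : ∀ {z q r} → q ℚ.+ r ℚ.< z → q ℚ.< z ℚ.- r
  +<⇒<- {z} {q} {r} <z = subst (ℚ._< z ℚ.- r) (p+q-q≡p q r) (ℚₚ.+-monoˡ-< (ℚ.- r) <z)

  interchange : ∀ a b c d → (a ℚ.+ b) ℚ.+ (c ℚ.+ d) ≡ (a ℚ.+ c) ℚ.+ (b ℚ.+ d)
  interchange a b c d = begin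
    (a ℚ.+ b) ℚ.+ (c ℚ.+ d)  ≡⟨ ℚₚ.+-assoc a b (c ℚ.+ d) ⟩
    a ℚ.+ (b ℚ.+ (c ℚ.+ d))  ≡⟨ cong (a ℚ.+_) (sym (ℚₚ.+-assoc b c d)) ⟩
    a ℚ.+ ((b ℚ.+ c) ℚ.+ d)  ≡⟨ cong (λ t → a ℚ.+ (t ℚ.+ d)) (ℚₚ.+-comm b c) ⟩
    a ℚ.+ ((c ℚ.+ b) ℚ.+ d)  ≡⟨ cong (a ℚ.+_) (ℚₚ.+-assoc c b d) ⟩
    a ℚ.+ (c ℚ.+ (b ℚ.+ d))  ≡⟨ sym (ℚₚ.+-assoc a c (b ℚ.+ d)) ⟩
    (a ℚ.+ c) ℚ.+ (b ℚ.+ d)  ∎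
    where open ≡-Reasoning

fromℚ : ℚ → ℝ
fromℚ x = record
  { L       = ℚ._< x
  ; U       = x ℚ.<_
  ; L-down  = ℚₚ.<-trans
  ; L-open  = λ q<x → let (r , q<r , r<x) = ℚₚ.<-dense q<x in r , q<r , r<x
  ; U-up    = λ q<r x<q → ℚₚ.<-trans x<q q<r
  ; U-open  = λ x<r → let (q , x<q , q<r) = ℚₚ.<-dense x<r in q , q<r , x<q
  ; L<U     = ℚₚ.<-trans
  ; located = loc
  }
  where
  loc : ∀ ε → 0ℚ ℚ.< ε → ∃[ q ] (q ℚ.< x × x ℚ.< q ℚ.+ ε)
  loc ε 0<ε = x ℚ.- δ , subst (x ℚ.- δ ℚ.<_) (p-q+q≡p x δ) (p<p+ε (x ℚ.- δ) (half>0 0<ε))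
            , subst (x ℚ.<_) eq (p<p+ε x (half>0 0<ε))
    where
    δ = ½ ℚ.* ε
    eq : x ℚ.+ δ ≡ (x ℚ.- δ) ℚ.+ ε
    eq = trans (cong (ℚ._+ δ) (sym (p-q+q≡p x δ)))
       (trans (ℚₚ.+-assoc (x ℚ.- δ) δ δ) (cong (x ℚ.- δ ℚ.+_) (halves ε)))

fromℕ : ℕ → ℝ
fromℕ n = fromℚ (+ n ℚ./ 1)

infixl 6 _+ᵣ_

_+ᵣ_ : ℝ → ℝ → ℝ
x +ᵣ y = record
  { L       = λ z → ∃[ q ] ∃[ r ] (L x q × L y r × z ≡ q ℚ.+ r)
  ; U       = λ z → ∃[ q ] ∃[ r ] (U x q × U y r × z ≡ q ℚ.+ r)
  ; L-down  = down
  ; L-open  = λ where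
      (q , r , Lq , Lr , refl) → let (q′ , q<q′ , Lq′) = L-open x Lq in
        q′ ℚ.+ r , ℚₚ.+-monoˡ-< r q<q′ , q′ , r , Lq′ , Lr , refl
  ; U-up    = up
  ; U-open  = λ where
      (q , r , Uq , Ur , refl) → let (q′ , q′<q , Uq′) = U-open x Uq in
        q′ ℚ.+ r , ℚₚ.+-monoˡ-< r q′<q , q′ , r , Uq′ , Ur , refl
  ; L<U     = λ where
      (q , r , Lq , Lr , refl) (q′ , r′ , Uq , Ur , refl) →
        ℚₚ.+-mono-< (L<U x Lq Uq) (L<U y Lr Ur)
  ; located = λ ε 0<ε → let
      (q , Lq , Uq) = located x (½ ℚ.* ε) (half>0 0<ε)
      (r , Lr , Ur) = located y (½ ℚ.* ε) (half>0 0<ε)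
      in q ℚ.+ r , (q , r , Lq , Lr , refl)
       , (q ℚ.+ ½ ℚ.* ε , r ℚ.+ ½ ℚ.* ε , Uq , Ur
         , trans (cong (q ℚ.+ r ℚ.+_) (sym (halves ε))) (interchange q r _ _))
  }
  where
  down : ∀ {z w} → z ℚ.< w → ∃[ q ] ∃[ r ] (L x q × L y r × w ≡ q ℚ.+ r) →
         ∃[ q ] ∃[ r ] (L x q × L y r × z ≡ q ℚ.+ r)
  down {z} z<w (q , r , Lq , Lr , refl) =
    z ℚ.- r , r , L-down x (<+⇒-< z<w) Lq , Lr , sym (p-q+q≡p z r)
  up : ∀ {z w} → z ℚ.< w → ∃[ q ] ∃[ r ] (U x q × U y r × z ≡ q ℚ.+ r) →
       ∃[ q ] ∃[ r ] (U x q × U y r × w ≡ q ℚ.+ r)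
  up {_} {w} z<w (q , r , Uq , Ur , refl) =
    w ℚ.- r , r , U-up x (+<⇒<- z<w) Uq , Ur , sym (p-q+q≡p w r)

infixr 8 _^ᶻ_

_^ᶻ_ : (b : ℕ) → .{{NonZero b}} → ℤ → ℚ
b ^ᶻ (+ n)    = + (b ℕ.^ n) ℚ./ 1
b ^ᶻ -[1+ n ] = (+ 1 ℚ./ (b ℕ.^ suc n)) {{ℕₚ.m^n≢0 b (suc n)}}

-- `Below b x y i j d` clears denominators in b^((i - j)/d) < x/y; swapping
-- (x , y) and (i , j) reverses it.

module LogLemmas where

  Below : (b x y i j d : ℕ) → Set
  Below b x y i j d = b ℕ.^ i ℕ.* y ℕ.^ d ℕ.< x ℕ.^ d ℕ.* b ℕ.^ j

  ^-*-distrib : ∀ m n k → (m ℕ.* n) ℕ.^ k ≡ m ℕ.^ k ℕ.* n ℕ.^ k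
  ^-*-distrib m n zero    = refl
  ^-*-distrib m n (suc k) = trans (cong (m ℕ.* n ℕ.*_) (^-*-distrib m n k))
                                  (shuffle m n (m ℕ.^ k) (n ℕ.^ k))
    where
    shuffle : ∀ a b c d → a ℕ.* b ℕ.* (c ℕ.* d) ≡ (a ℕ.* c) ℕ.* (b ℕ.* d)
    shuffle = ℕ-Solver.solve-∀

  ^-swap : ∀ m j k → (m ℕ.^ j) ℕ.^ k ≡ (m ℕ.^ k) ℕ.^ j
  ^-swap m j k = trans (ℕₚ.^-*-assoc m j k)
    (trans (cong (m ℕ.^_) (ℕₚ.*-comm j k)) (sym (ℕₚ.^-*-assoc m k j)))

  pow-prod : ∀ m n i k d → (m ℕ.^ i ℕ.* n ℕ.^ k) ℕ.^ d ≡ m ℕ.^ (i ℕ.* d) ℕ.* (n ℕ.^ k) ℕ.^ d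
  pow-prod m n i k d = trans (^-*-distrib (m ℕ.^ i) (n ℕ.^ k) d)
    (cong (ℕ._* (n ℕ.^ k) ℕ.^ d) (ℕₚ.^-*-assoc m i d))

  root-< : ∀ {m n} d → m ℕ.^ d ℕ.< n ℕ.^ d → m ℕ.< n
  root-< {m} {n} d lt = ℕₚ.≰⇒> λ n≤m → ℕₚ.<⇒≱ lt (ℕₚ.^-monoˡ-≤ d n≤m)

  Below-down : ∀ b x y i j d i′ j′ d′ → .{{NonZero b}} → .{{NonZero d′}} →
    i′ ℕ.* d ℕ.+ j ℕ.* d′ ℕ.≤ i ℕ.* d′ ℕ.+ j′ ℕ.* d →
    Below b x y i j d → Below b x y i′ j′ d′
  Below-down b x y i j d i′ j′ d′ le lt =
    root-< d (subst₂ ℕ._<_ (sym eqL) (sym eqR) (ℕₚ.*-cancelʳ-< A (C ℕ.* Y) (X ℕ.* B) chain))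
    where
    A = b ℕ.^ (j ℕ.* d′)
    B = b ℕ.^ (j′ ℕ.* d)
    C = b ℕ.^ (i′ ℕ.* d)
    E = b ℕ.^ (i ℕ.* d′)
    X = (x ℕ.^ d) ℕ.^ d′
    Y = (y ℕ.^ d) ℕ.^ d′
    eqL : (b ℕ.^ i′ ℕ.* y ℕ.^ d′) ℕ.^ d ≡ C ℕ.* Y
    eqL = trans (pow-prod b y i′ d′ d) (cong (C ℕ.*_) (^-swap y d′ d))
    eqR : (x ℕ.^ d′ ℕ.* b ℕ.^ j′) ℕ.^ d ≡ X ℕ.* B
    eqR = trans (^-*-distrib (x ℕ.^ d′) (b ℕ.^ j′) d)
                (cong₂ ℕ._*_ (^-swap x d′ d) (ℕₚ.^-*-assoc b j′ d))
    raised : E ℕ.* Y ℕ.< X ℕ.* A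
    raised = subst₂ ℕ._<_ (pow-prod b y i d d′)
      (trans (^-*-distrib (x ℕ.^ d) (b ℕ.^ j) d′) (cong (X ℕ.*_) (ℕₚ.^-*-assoc b j d′)))
      (ℕₚ.^-monoˡ-< d′ lt)
    exps : C ℕ.* A ℕ.≤ E ℕ.* B
    exps = subst₂ ℕ._≤_ (ℕₚ.^-distribˡ-+-* b (i′ ℕ.* d) (j ℕ.* d′))
      (ℕₚ.^-distribˡ-+-* b (i ℕ.* d′) (j′ ℕ.* d)) (ℕₚ.^-monoʳ-≤ b le)
    swap : ∀ u v w → u ℕ.* v ℕ.* w ≡ u ℕ.* w ℕ.* v
    swap = ℕ-Solver.solve-∀
    chain : C ℕ.* Y ℕ.* A ℕ.< X ℕ.* B ℕ.* A
    chain = begin-strict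
      C ℕ.* Y ℕ.* A  ≡⟨ swap C Y A ⟩
      C ℕ.* A ℕ.* Y  ≤⟨ ℕₚ.*-monoˡ-≤ Y exps ⟩
      E ℕ.* B ℕ.* Y  ≡⟨ swap E B Y ⟩
      E ℕ.* Y ℕ.* B  <⟨ ℕₚ.*-monoˡ-< B {{ℕₚ.m^n≢0 b (j′ ℕ.* d)}} raised ⟩
      X ℕ.* A ℕ.* B  ≡⟨ swap X A B ⟩
      X ℕ.* B ℕ.* A  ∎
      where open ℕₚ.≤-Reasoning

  Below-swap : ∀ b x y i j d → x ℕ.^ d ℕ.* b ℕ.^ j ℕ.< b ℕ.^ i ℕ.* y ℕ.^ d → Below b y x j i d
  Below-swap b x y i j d = subst₂ ℕ._<_ (ℕₚ.*-comm (x ℕ.^ d) (b ℕ.^ j)) (ℕₚ.*-comm (b ℕ.^ i) (y ℕ.^ d))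

  bernoulli : ∀ u k → u ℕ.^ k ℕ.* (u ℕ.+ k) ℕ.≤ suc u ℕ.^ k ℕ.* u
  bernoulli u zero    = ℕₚ.≤-reflexive (cong (ℕ._+ 0) (ℕₚ.+-identityʳ u))
  bernoulli u (suc k) = begin
    u ℕ.* u ℕ.^ k ℕ.* (u ℕ.+ suc k)          ≤⟨ ℕₚ.m≤m+n _ (u ℕ.^ k ℕ.* k) ⟩
    u ℕ.* u ℕ.^ k ℕ.* (u ℕ.+ suc k) ℕ.+ u ℕ.^ k ℕ.* k  ≡⟨ eq u k (u ℕ.^ k) ⟩
    suc u ℕ.* (u ℕ.^ k ℕ.* (u ℕ.+ k))        ≤⟨ ℕₚ.*-monoʳ-≤ (suc u) (bernoulli u k) ⟩
    suc u ℕ.* (suc u ℕ.^ k ℕ.* u)            ≡⟨ sym (ℕₚ.*-assoc (suc u) (suc u ℕ.^ k) u) ⟩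
    suc u ℕ.* suc u ℕ.^ k ℕ.* u              ∎
    where
    open ℕₚ.≤-Reasoning
    eq : ∀ u k p → u ℕ.* p ℕ.* (u ℕ.+ suc k) ℕ.+ p ℕ.* k ≡ suc u ℕ.* (p ℕ.* (u ℕ.+ k))
    eq = ℕ-Solver.solve-∀

  outgrow : ∀ b u v → .{{NonZero b}} → .{{NonZero u}} → u ℕ.< v → b ℕ.* u ℕ.^ (b ℕ.* u) ℕ.< v ℕ.^ (b ℕ.* u)
  outgrow b u v u<v = begin-strict
    b ℕ.* u ℕ.^ k      <⟨ ℕₚ.*-monoˡ-< (u ℕ.^ k) {{ℕₚ.m^n≢0 u k}} (ℕₚ.n<1+n b) ⟩
    suc b ℕ.* u ℕ.^ k  ≤⟨ ℕₚ.*-cancelʳ-≤ _ _ u (subst (ℕ._≤ suc u ℕ.^ k ℕ.* u) (eq b u (u ℕ.^ k)) (bernoulli u k)) ⟩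
    suc u ℕ.^ k        ≤⟨ ℕₚ.^-monoˡ-≤ k u<v ⟩
    v ℕ.^ k            ∎
    where
    open ℕₚ.≤-Reasoning
    k = b ℕ.* u
    eq : ∀ b u p → p ℕ.* (u ℕ.+ b ℕ.* u) ≡ suc b ℕ.* p ℕ.* u
    eq = ℕ-Solver.solve-∀

  Below-open : ∀ b x y i j d → .{{NonZero b}} → .{{NonZero y}} → Below b x y i j d →
    Σ[ k ∈ ℕ ] (NonZero k × Below b x y (suc (i ℕ.* k)) (j ℕ.* k) (d ℕ.* k))
  Below-open b x y i j d lt = k , ℕₚ.m*n≢0 b u , subst₂ ℕ._<_ eqL eqR (outgrow b u v lt)
    where
    u = b ℕ.^ i ℕ.* y ℕ.^ d
    v = x ℕ.^ d ℕ.* b ℕ.^ j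
    instance
      u≢0 : NonZero u
      u≢0 = ℕₚ.m*n≢0 (b ℕ.^ i) (y ℕ.^ d) {{ℕₚ.m^n≢0 b i}} {{ℕₚ.m^n≢0 y d}}
    k = b ℕ.* u
    eqL : b ℕ.* u ℕ.^ k ≡ b ℕ.^ suc (i ℕ.* k) ℕ.* y ℕ.^ (d ℕ.* k)
    eqL = trans (cong (b ℕ.*_) (trans (pow-prod b y i d k)
            (cong (b ℕ.^ (i ℕ.* k) ℕ.*_) (ℕₚ.^-*-assoc y d k))))
          (sym (ℕₚ.*-assoc b (b ℕ.^ (i ℕ.* k)) (y ℕ.^ (d ℕ.* k))))
    eqR : v ℕ.^ k ≡ x ℕ.^ (d ℕ.* k) ℕ.* b ℕ.^ (j ℕ.* k)
    eqR = trans (pow-prod x b d j k) (cong (x ℕ.^ (d ℕ.* k) ℕ.*_) (ℕₚ.^-*-assoc b j k))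

  n<b^n : ∀ b → 1 ℕ.< b → ∀ n → n ℕ.< b ℕ.^ n
  n<b^n b 1<b zero    = s≤s z≤n
  n<b^n b 1<b (suc n) = begin-strict
    suc n            ≤⟨ n<b^n b 1<b n ⟩
    b ℕ.^ n          <⟨ ℕₚ.^-monoʳ-< b 1<b (ℕₚ.n<1+n n) ⟩
    b ℕ.* b ℕ.^ n    ∎
    where open ℕₚ.≤-Reasoning

  last : ∀ (f : ℕ → ℕ) v n → f 0 ℕ.< v → v ℕ.≤ f n → ∃[ k ] (f k ℕ.< v × v ℕ.≤ f (suc k))
  last f v zero    f0<v v≤f0 = ⊥-elim (ℕₚ.<⇒≱ f0<v v≤f0)
  last f v (suc n) f0<v v≤fn with f n ℕₚ.<? v
  ... | yes fn<v = n , fn<v , v≤fn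
  ... | no  fn≮v = last f v n f0<v (ℕₚ.≮⇒≥ fn≮v)

  Below-located : ∀ b x y d → 1 ℕ.< b → .{{NonZero x}} → .{{NonZero y}} →
    Σ[ i ∈ ℕ ] Σ[ j ∈ ℕ ] (Below b x y i j d × Below b y x j (2 ℕ.+ i) d)
  Below-located b x y d 1<b = k , Y , lo , Below-swap b x y (2 ℕ.+ k) Y d hi′
    where
    X = x ℕ.^ d
    Y = y ℕ.^ d
    instance
      b≢0 : NonZero b
      b≢0 = ℕ.>-nonZero (ℕₚ.<-trans (s≤s z≤n) 1<b)
      X≢0 : NonZero X
      X≢0 = ℕₚ.m^n≢0 x d
      Y≢0 : NonZero Y
      Y≢0 = ℕₚ.m^n≢0 y d
    f : ℕ → ℕ
    f n = b ℕ.^ n ℕ.* Y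
    v = X ℕ.* b ℕ.^ Y
    f0<v : f 0 ℕ.< v
    f0<v = begin-strict
      1 ℕ.* Y        ≡⟨ ℕₚ.*-identityˡ Y ⟩
      Y              <⟨ n<b^n b 1<b Y ⟩
      b ℕ.^ Y        ≤⟨ ℕₚ.m≤n*m (b ℕ.^ Y) X ⟩
      X ℕ.* b ℕ.^ Y  ∎
      where open ℕₚ.≤-Reasoning
    v≤f : v ℕ.≤ f (X ℕ.+ Y)
    v≤f = begin
      X ℕ.* b ℕ.^ Y          ≤⟨ ℕₚ.*-monoˡ-≤ (b ℕ.^ Y) (ℕₚ.<⇒≤ (n<b^n b 1<b X)) ⟩
      b ℕ.^ X ℕ.* b ℕ.^ Y    ≡⟨ sym (ℕₚ.^-distribˡ-+-* b X Y) ⟩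
      b ℕ.^ (X ℕ.+ Y)        ≤⟨ ℕₚ.m≤m*n (b ℕ.^ (X ℕ.+ Y)) Y ⟩
      f (X ℕ.+ Y)            ∎
      where open ℕₚ.≤-Reasoning
    found = last f v (X ℕ.+ Y) f0<v v≤f
    k  = proj₁ found
    lo = proj₁ (proj₂ found)
    hi = proj₂ (proj₂ found)
    hi′ : v ℕ.< b ℕ.^ (2 ℕ.+ k) ℕ.* Y
    hi′ = ℕₚ.≤-<-trans hi (ℕₚ.*-monoˡ-< Y (ℕₚ.^-monoʳ-< b 1<b (ℕₚ.n<1+n (suc k))))

  -- `Rep q i j e` says q = (i - j)/e.

  record Rep (q : ℚ) (i j e : ℕ) .{{e≢0 : NonZero e}} : Set where
    constructor rep
    field equality : toℚᵘ q ℚᵘ.≃ (+ i ℤ.- + j) ℚᵘ./ e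

  frac : (i j e : ℕ) → .{{NonZero e}} → ℚ
  frac i j e = (+ i ℤ.- + j) ℚ./ e

  Rep-frac : ∀ i j e .{{_ : NonZero e}} → Rep (frac i j e) i j e
  Rep-frac i j (suc e) = rep (ℚₚ.toℚᵘ-fromℚᵘ (mkℚᵘ (+ i ℤ.- + j) e))

  pos neg : ℤ → ℕ
  pos (+ n)    = n
  pos -[1+ n ] = 0
  neg (+ n)    = 0
  neg -[1+ n ] = suc n

  pos-neg : ∀ a → + pos a ℤ.- + neg a ≡ a
  pos-neg (+ n)    = ℤₚ.+-identityʳ (+ n)
  pos-neg -[1+ n ] = refl

  Rep-self : ∀ q → Rep q (pos (↥ q)) (neg (↥ q)) (↧ₙ q)
  Rep-self q@(mkℚ a d _) = rep (ℚᵘₚ.≃-reflexive (cong (λ z → mkℚᵘ z d) (sym (pos-neg a))))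

  cross : ∀ i j e i′ j′ e′ →
    ((+ i ℤ.- + j) ℤ.* + e′ ℤ.+ (+ j ℤ.* + e′ ℤ.+ + j′ ℤ.* + e) ≡ + (i ℕ.* e′ ℕ.+ j′ ℕ.* e))
    × ((+ i′ ℤ.- + j′) ℤ.* + e ℤ.+ (+ j ℤ.* + e′ ℤ.+ + j′ ℤ.* + e) ≡ + (i′ ℕ.* e ℕ.+ j ℕ.* e′))
  cross i j e i′ j′ e′ =
      trans (eq₁ (+ i) (+ j) (+ e) (+ j′) (+ e′)) (cast i e′ j′ e)
    , trans (eq₂ (+ j) (+ e) (+ i′) (+ j′) (+ e′)) (cast i′ e j e′)
    where
    cast : ∀ a b c d → + a ℤ.* + b ℤ.+ + c ℤ.* + d ≡ + (a ℕ.* b ℕ.+ c ℕ.* d)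
    cast a b c d = trans (cong₂ ℤ._+_ (sym (ℤₚ.pos-* a b)) (sym (ℤₚ.pos-* c d)))
                         (sym (ℤₚ.pos-+ (a ℕ.* b) (c ℕ.* d)))
    eq₁ : ∀ i j e j′ e′ → (i ℤ.- j) ℤ.* e′ ℤ.+ (j ℤ.* e′ ℤ.+ j′ ℤ.* e) ≡ i ℤ.* e′ ℤ.+ j′ ℤ.* e
    eq₁ = ℤ-Solver.solve-∀
    eq₂ : ∀ j e i′ j′ e′ → (i′ ℤ.- j′) ℤ.* e ℤ.+ (j ℤ.* e′ ℤ.+ j′ ℤ.* e) ≡ i′ ℤ.* e ℤ.+ j ℤ.* e′
    eq₂ = ℤ-Solver.solve-∀

  Rep-<⁻ : ∀ {q r} i j e i′ j′ e′ .{{_ : NonZero e}} .{{_ : NonZero e′}} →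
    Rep q i j e → Rep r i′ j′ e′ → q ℚ.< r → i ℕ.* e′ ℕ.+ j′ ℕ.* e ℕ.< i′ ℕ.* e ℕ.+ j ℕ.* e′
  Rep-<⁻ i j e@(suc _) i′ j′ e′@(suc _) (rep q≃) (rep r≃) q<r = ℤₚ.drop‿+<+
    (subst₂ ℤ._<_ (proj₁ (cross i j e i′ j′ e′)) (proj₂ (cross i j e i′ j′ e′))
      (ℤₚ.+-monoˡ-< (+ j ℤ.* + e′ ℤ.+ + j′ ℤ.* + e)
        (ℚᵘₚ.drop-*<* (ℚᵘₚ.<-respˡ-≃ q≃ (ℚᵘₚ.<-respʳ-≃ r≃ (ℚₚ.toℚᵘ-mono-< q<r))))))

  Rep-<⁺ : ∀ {q r} i j e i′ j′ e′ .{{_ : NonZero e}} .{{_ : NonZero e′}} →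
    Rep q i j e → Rep r i′ j′ e′ → i ℕ.* e′ ℕ.+ j′ ℕ.* e ℕ.< i′ ℕ.* e ℕ.+ j ℕ.* e′ → q ℚ.< r
  Rep-<⁺ i j e@(suc _) i′ j′ e′@(suc _) (rep q≃) (rep r≃) lt = ℚₚ.toℚᵘ-cancel-<
    (ℚᵘₚ.<-respˡ-≃ (ℚᵘₚ.≃-sym q≃) (ℚᵘₚ.<-respʳ-≃ (ℚᵘₚ.≃-sym r≃) (*<*
      (ℤₚ.≰⇒> λ le → ℕₚ.<⇒≱ lt (ℤₚ.drop‿+≤+
        (subst₂ ℤ._≤_ (proj₂ (cross i j e i′ j′ e′)) (proj₁ (cross i j e i′ j′ e′))
          (ℤₚ.+-monoˡ-≤ (+ j ℤ.* + e′ ℤ.+ + j′ ℤ.* + e) le)))))))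

  Rep-≤⁻ : ∀ {q r} i j e i′ j′ e′ .{{_ : NonZero e}} .{{_ : NonZero e′}} →
    Rep q i j e → Rep r i′ j′ e′ → q ℚ.≤ r → i ℕ.* e′ ℕ.+ j′ ℕ.* e ℕ.≤ i′ ℕ.* e ℕ.+ j ℕ.* e′
  Rep-≤⁻ {q} {r} i j e i′ j′ e′ q≃ r≃ q≤r = ℕₚ.≮⇒≥ λ lt →
    ℚₚ.<-irrefl refl (ℚₚ.<-≤-trans (Rep-<⁺ {r} {q} i′ j′ e′ i j e r≃ q≃ lt) q≤r)

  Rep-+ : ∀ {q r} i j e i′ j′ .{{_ : NonZero e}} → Rep q i j e → Rep r i′ j′ e →
    Rep (q ℚ.+ r) (i ℕ.+ i′) (j ℕ.+ j′) e
  Rep-+ {q} {r} i j e@(suc _) i′ j′ (rep q≃) (rep r≃) = rep (ℚᵘₚ.≃-trans (ℚₚ.toℚᵘ-homo-+ q r)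
    (ℚᵘₚ.≃-trans (ℚᵘₚ.+-cong q≃ r≃) (*≡* eq)))
    where
    ring : ∀ i j i′ j′ e → ((i ℤ.- j) ℤ.* e ℤ.+ (i′ ℤ.- j′) ℤ.* e) ℤ.* e ≡ ((i ℤ.+ i′) ℤ.- (j ℤ.+ j′)) ℤ.* (e ℤ.* e)
    ring = ℤ-Solver.solve-∀
    eq : ((+ i ℤ.- + j) ℤ.* + e ℤ.+ (+ i′ ℤ.- + j′) ℤ.* + e) ℤ.* + e
       ≡ (+ (i ℕ.+ i′) ℤ.- + (j ℕ.+ j′)) ℤ.* + (e ℕ.* e)
    eq = trans (ring (+ i) (+ j) (+ i′) (+ j′) (+ e)) (cong ((+ (i ℕ.+ i′) ℤ.- + (j ℕ.+ j′)) ℤ.*_) (sym (ℤₚ.pos-* e e)))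

  Rep-* : ∀ {q r} m d n e .{{_ : NonZero d}} .{{_ : NonZero e}} .{{_ : NonZero (d ℕ.* e)}} →
    Rep q m 0 d → Rep r n 0 e → Rep (q ℚ.* r) (m ℕ.* n) 0 (d ℕ.* e)
  Rep-* {q} {r} m d@(suc _) n e@(suc _) (rep q≃) (rep r≃) = rep (ℚᵘₚ.≃-trans (ℚₚ.toℚᵘ-homo-* q r)
    (ℚᵘₚ.≃-trans (ℚᵘₚ.*-cong q≃ r≃) (ℚᵘₚ.≃-reflexive (cong (λ z → mkℚᵘ z _) eq))))
    where
    eq : (+ m ℤ.- + 0) ℤ.* (+ n ℤ.- + 0) ≡ + (m ℕ.* n) ℤ.- + 0
    eq = trans (cong₂ ℤ._*_ (ℤₚ.+-identityʳ (+ m)) (ℤₚ.+-identityʳ (+ n)))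
         (trans (sym (ℤₚ.pos-* m n)) (sym (ℤₚ.+-identityʳ (+ (m ℕ.* n)))))

  Rep-^ : ∀ {c} x y .{{_ : NonZero y}} → Rep c x 0 y → ∀ d → Rep (c ^ℚ d) (x ℕ.^ d) 0 (y ℕ.^ d) {{ℕₚ.m^n≢0 y d}}
  Rep-^ x y c≃ zero    = rep ℚᵘₚ.≃-refl
  Rep-^ {c} x y c≃ (suc d) = Rep-* {c} {c ^ℚ d} x y (x ℕ.^ d) (y ℕ.^ d)
    {{_}} {{ℕₚ.m^n≢0 y d}} {{ℕₚ.m^n≢0 y (suc d)}} c≃ (Rep-^ {c} x y c≃ d)

  Rep-^ᶻ : ∀ b .{{_ : NonZero b}} a → Rep (b ^ᶻ a) (b ℕ.^ pos a) 0 (b ℕ.^ neg a) {{ℕₚ.m^n≢0 b (neg a)}}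
  Rep-^ᶻ b (+ n)    = rep (ℚᵘₚ.≃-trans (ℚₚ.toℚᵘ-fromℚᵘ (mkℚᵘ (+ (b ℕ.^ n)) 0))
    (ℚᵘₚ.≃-reflexive (cong (λ z → mkℚᵘ z 0) (sym (ℤₚ.+-identityʳ _)))))
  Rep-^ᶻ b -[1+ n ] = Rep-frac 1 0 (b ℕ.^ suc n) {{ℕₚ.m^n≢0 b (suc n)}}

  module LogCut (b : ℕ) .{{_ : NonTrivial b}} (c : ℚ) .{{c>0 : ℚ.Positive c}} where

    instance
      b≢0 : NonZero b
      b≢0 = ℕ.nonTrivial⇒nonZero b

    Lo Hi : ℚ → Set
    Lo q = b ^ᶻ (↥ q) ℚ.< c ^ℚ (↧ₙ q)
    Hi q = c ^ℚ (↧ₙ q) ℚ.< b ^ᶻ (↥ q)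

    x y : ℕ
    x = pos (↥ c)
    y = ↧ₙ c

    positive⇒x≢0 : ∀ c → .(ℚ.Positive c) → NonZero (pos (↥ c))
    positive⇒x≢0 (mkℚ ℤ.+[1+ _ ] _ _) _ = _

    positive⇒neg≡0 : ∀ c → .(ℚ.Positive c) → neg (↥ c) ≡ 0
    positive⇒neg≡0 (mkℚ ℤ.+[1+ _ ] _ _) _ = refl

    instance
      x≢0 : NonZero x
      x≢0 = positive⇒x≢0 c c>0

    Rep-c : Rep c x 0 y
    Rep-c = subst (λ j → Rep c x j y) (positive⇒neg≡0 c c>0) (Rep-self c)

    i j : ℚ → ℕ
    i q = pos (↥ q)
    j q = neg (↥ q)

    Lo⇒ : ∀ q → Lo q → Below b x y (i q) (j q) (↧ₙ q)
    Lo⇒ q lt = subst₂ ℕ._<_ (ℕₚ.+-identityʳ _) (ℕₚ.+-identityʳ _)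
      (Rep-<⁻ {b ^ᶻ ↥ q} {c ^ℚ ↧ₙ q} _ 0 _ _ 0 _ {{ℕₚ.m^n≢0 b (j q)}} {{ℕₚ.m^n≢0 y (↧ₙ q)}}
        (Rep-^ᶻ b (↥ q)) (Rep-^ {c} x y Rep-c (↧ₙ q)) lt)

    Lo⇐ : ∀ q → Below b x y (i q) (j q) (↧ₙ q) → Lo q
    Lo⇐ q lt = Rep-<⁺ {b ^ᶻ ↥ q} {c ^ℚ ↧ₙ q} _ 0 _ _ 0 _ {{ℕₚ.m^n≢0 b (j q)}} {{ℕₚ.m^n≢0 y (↧ₙ q)}}
      (Rep-^ᶻ b (↥ q)) (Rep-^ {c} x y Rep-c (↧ₙ q))
      (subst₂ ℕ._<_ (sym (ℕₚ.+-identityʳ _)) (sym (ℕₚ.+-identityʳ _)) lt)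

    Hi⇒ : ∀ q → Hi q → Below b y x (j q) (i q) (↧ₙ q)
    Hi⇒ q lt = Below-swap b x y (i q) (j q) (↧ₙ q) (subst₂ ℕ._<_ (ℕₚ.+-identityʳ _) (ℕₚ.+-identityʳ _)
      (Rep-<⁻ {c ^ℚ ↧ₙ q} {b ^ᶻ ↥ q} _ 0 _ _ 0 _ {{ℕₚ.m^n≢0 y (↧ₙ q)}} {{ℕₚ.m^n≢0 b (j q)}}
        (Rep-^ {c} x y Rep-c (↧ₙ q)) (Rep-^ᶻ b (↥ q)) lt))

    Hi⇐ : ∀ q → Below b y x (j q) (i q) (↧ₙ q) → Hi q
    Hi⇐ q lt = Rep-<⁺ {c ^ℚ ↧ₙ q} {b ^ᶻ ↥ q} _ 0 _ _ 0 _ {{ℕₚ.m^n≢0 y (↧ₙ q)}} {{ℕₚ.m^n≢0 b (j q)}}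
      (Rep-^ {c} x y Rep-c (↧ₙ q)) (Rep-^ᶻ b (↥ q))
      (subst₂ ℕ._<_ (trans (ℕₚ.*-comm (b ℕ.^ j q) (x ℕ.^ ↧ₙ q)) (sym (ℕₚ.+-identityʳ _)))
                    (trans (ℕₚ.*-comm (y ℕ.^ ↧ₙ q) (b ℕ.^ i q)) (sym (ℕₚ.+-identityʳ _))) lt)

    flip : ∀ a b c d → a ℕ.+ b ℕ.≤ c ℕ.+ d → b ℕ.+ a ℕ.≤ d ℕ.+ c
    flip a b c d = subst₂ ℕ._≤_ (ℕₚ.+-comm a b) (ℕₚ.+-comm c d)

    Lo-frac : ∀ q i′ j′ e .{{_ : NonZero e}} → Rep q i′ j′ e → Below b x y i′ j′ e → Lo q
    Lo-frac q i′ j′ e q≃ lt = Lo⇐ q (Below-down b x y i′ j′ e (i q) (j q) (↧ₙ q)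
      (Rep-≤⁻ {q} {q} _ _ _ _ _ _ (Rep-self q) q≃ ℚₚ.≤-refl) lt)

    Hi-frac : ∀ q i′ j′ e .{{_ : NonZero e}} → Rep q i′ j′ e → Below b y x j′ i′ e → Hi q
    Hi-frac q i′ j′ e q≃ lt = Hi⇐ q (Below-down b y x j′ i′ e (j q) (i q) (↧ₙ q)
      (flip (i′ ℕ.* ↧ₙ q) (j q ℕ.* e) (i q ℕ.* e) (j′ ℕ.* ↧ₙ q)
        (Rep-≤⁻ {q} {q} _ _ _ _ _ _ q≃ (Rep-self q) ℚₚ.≤-refl)) lt)

    Lo-down-≤ : ∀ {q r} → q ℚ.≤ r → Lo r → Lo q
    Lo-down-≤ {q} {r} q≤r lo = Lo⇐ q (Below-down b x y (i r) (j r) (↧ₙ r) (i q) (j q) (↧ₙ q)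
      (Rep-≤⁻ {q} {r} _ _ _ _ _ _ (Rep-self q) (Rep-self r) q≤r) (Lo⇒ r lo))

    Hi-up-≤ : ∀ {q r} → q ℚ.≤ r → Hi q → Hi r
    Hi-up-≤ {q} {r} q≤r hi = Hi⇐ r (Below-down b y x (j q) (i q) (↧ₙ q) (j r) (i r) (↧ₙ r)
      (flip (i q ℕ.* ↧ₙ r) (j r ℕ.* ↧ₙ q) (i r ℕ.* ↧ₙ q) (j q ℕ.* ↧ₙ r)
        (Rep-≤⁻ {q} {r} _ _ _ _ _ _ (Rep-self q) (Rep-self r) q≤r)) (Hi⇒ q hi))

    Lo-open : ∀ {q} → Lo q → ∃[ r ] (q ℚ.< r × Lo r)
    Lo-open {q} lo with Below-open b x y (i q) (j q) (↧ₙ q) (Lo⇒ q lo)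
    ... | k , k≢0 , lt = r , Rep-<⁺ {q} {r} _ _ _ _ _ _ (Rep-self q) r≃ bigger , Lo-frac r _ _ _ r≃ lt
      where
      instance
        e≢0 : NonZero (↧ₙ q ℕ.* k)
        e≢0 = ℕₚ.m*n≢0 (↧ₙ q) k {{_}} {{k≢0}}
      r = frac (suc (i q ℕ.* k)) (j q ℕ.* k) (↧ₙ q ℕ.* k)
      r≃ : Rep r (suc (i q ℕ.* k)) (j q ℕ.* k) (↧ₙ q ℕ.* k)
      r≃ = Rep-frac (suc (i q ℕ.* k)) (j q ℕ.* k) (↧ₙ q ℕ.* k)
      eq : ∀ i j d k → suc (i ℕ.* k) ℕ.* d ℕ.+ j ℕ.* (d ℕ.* k) ≡ d ℕ.+ (i ℕ.* (d ℕ.* k) ℕ.+ (j ℕ.* k) ℕ.* d)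
      eq = ℕ-Solver.solve-∀
      bigger : i q ℕ.* (↧ₙ q ℕ.* k) ℕ.+ (j q ℕ.* k) ℕ.* ↧ₙ q ℕ.< suc (i q ℕ.* k) ℕ.* ↧ₙ q ℕ.+ j q ℕ.* (↧ₙ q ℕ.* k)
      bigger = subst (lhs ℕ.<_) (sym (eq (i q) (j q) (↧ₙ q) k)) (ℕₚ.m<n+m lhs {↧ₙ q} (s≤s z≤n))
        where lhs = i q ℕ.* (↧ₙ q ℕ.* k) ℕ.+ (j q ℕ.* k) ℕ.* ↧ₙ q

    Hi-open : ∀ {r} → Hi r → ∃[ q ] (q ℚ.< r × Hi q)
    Hi-open {r} hi with Below-open b y x (j r) (i r) (↧ₙ r) (Hi⇒ r hi)
    ... | k , k≢0 , lt = q , Rep-<⁺ {q} {r} _ _ _ _ _ _ q≃ (Rep-self r) smaller , Hi-frac q _ _ _ q≃ lt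
      where
      instance
        e≢0 : NonZero (↧ₙ r ℕ.* k)
        e≢0 = ℕₚ.m*n≢0 (↧ₙ r) k {{_}} {{k≢0}}
      q = frac (i r ℕ.* k) (suc (j r ℕ.* k)) (↧ₙ r ℕ.* k)
      q≃ : Rep q (i r ℕ.* k) (suc (j r ℕ.* k)) (↧ₙ r ℕ.* k)
      q≃ = Rep-frac (i r ℕ.* k) (suc (j r ℕ.* k)) (↧ₙ r ℕ.* k)
      eq : ∀ i j d k → i ℕ.* (d ℕ.* k) ℕ.+ suc (j ℕ.* k) ℕ.* d ≡ d ℕ.+ ((i ℕ.* k) ℕ.* d ℕ.+ j ℕ.* (d ℕ.* k))
      eq = ℕ-Solver.solve-∀
      smaller : (i r ℕ.* k) ℕ.* ↧ₙ r ℕ.+ j r ℕ.* (↧ₙ r ℕ.* k) ℕ.< i r ℕ.* (↧ₙ r ℕ.* k) ℕ.+ suc (j r ℕ.* k) ℕ.* ↧ₙ r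
      smaller = subst (lhs ℕ.<_) (sym (eq (i r) (j r) (↧ₙ r) k)) (ℕₚ.m<n+m lhs {↧ₙ r} (s≤s z≤n))
        where lhs = (i r ℕ.* k) ℕ.* ↧ₙ r ℕ.+ j r ℕ.* (↧ₙ r ℕ.* k)

    Lo<Hi : ∀ {q r} → Lo q → Hi r → q ℚ.< r
    Lo<Hi lo hi = ℚₚ.≰⇒> λ r≤q → ℚₚ.<-asym (Lo-down-≤ r≤q lo) hi

    log-located : ∀ ε → 0ℚ ℚ.< ε → ∃[ q ] (Lo q × Hi (q ℚ.+ ε))
    log-located ε@(mkℚ a f-1 _) 0<ε with Below-located b x y (2 ℕ.* suc f-1) (ℕ.nonTrivial⇒n>1 b)
    ... | i′ , j′ , lo , hi = q , Lo-frac q i′ j′ d q≃ lo , Hi-up-≤ {q ℚ.+ δ} (ℚₚ.+-monoʳ-≤ q δ≤ε) hi′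
      where
      d = 2 ℕ.* suc f-1
      q = frac i′ j′ d
      q≃ : Rep q i′ j′ d
      q≃ = Rep-frac i′ j′ d
      δ = frac 2 0 d
      hi′ : Hi (q ℚ.+ δ)
      hi′ = Hi-frac (q ℚ.+ δ) (2 ℕ.+ i′) j′ d
        (subst₂ (λ u v → Rep (q ℚ.+ δ) u v d) (ℕₚ.+-comm i′ 2) (ℕₚ.+-identityʳ j′)
          (Rep-+ {q} {δ} i′ j′ d 2 0 q≃ (Rep-frac 2 0 d))) hi
      0<a : 0 ℕ.* suc f-1 ℕ.+ neg a ℕ.* 1 ℕ.< pos a ℕ.* 1 ℕ.+ 0 ℕ.* suc f-1
      0<a = Rep-<⁻ {0ℚ} {ε} 0 0 1 _ _ _ (rep ℚᵘₚ.≃-refl) (Rep-self ε) 0<ε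
      neg<pos : neg a ℕ.< pos a
      neg<pos = subst₂ ℕ._<_ (ℕₚ.*-identityʳ _) (trans (ℕₚ.+-identityʳ _) (ℕₚ.*-identityʳ _)) 0<a
      ε<δ⇒ : ∀ f p n → p ℕ.* (2 ℕ.* f) ℕ.+ 0 ℕ.* f ℕ.< 2 ℕ.* f ℕ.+ n ℕ.* (2 ℕ.* f) → n ℕ.< p → ⊥
      ε<δ⇒ f p n lt n<p = ℕₚ.<⇒≱ lt (begin
        suc n ℕ.* (2 ℕ.* f)        ≤⟨ ℕₚ.*-monoˡ-≤ (2 ℕ.* f) n<p ⟩
        p ℕ.* (2 ℕ.* f)            ≤⟨ ℕₚ.m≤m+n _ _ ⟩
        p ℕ.* (2 ℕ.* f) ℕ.+ 0 ℕ.* f  ∎)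
        where open ℕₚ.≤-Reasoning
      δ≤ε : δ ℚ.≤ ε
      δ≤ε = ℚₚ.≮⇒≥ λ ε<δ → ε<δ⇒ (suc f-1) (pos a) (neg a)
        (Rep-<⁻ {ε} {δ} _ _ _ 2 0 d (Rep-self ε) (Rep-frac 2 0 d) ε<δ) neg<pos

-- q = n/d < log_b c exactly when b^n < c^d.

log : (b : ℕ) → .{{NonTrivial b}} → (c : ℚ) → .{{ℚ.Positive c}} → ℝ
log b c = record
  { L       = λ q → b ^ᶻ ↥ q ℚ.< c ^ℚ (↧ₙ q)
  ; U       = λ q → c ^ℚ (↧ₙ q) ℚ.< b ^ᶻ ↥ q
  ; L-down  = λ q<r → Lo-down-≤ (ℚₚ.<⇒≤ q<r)
  ; L-open  = Lo-open
  ; U-up    = λ q<r → Hi-up-≤ (ℚₚ.<⇒≤ q<r)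
  ; U-open  = Hi-open
  ; L<U     = Lo<Hi
  ; located = log-located
  }
  where open LogLemmas.LogCut b c

-- `b j` is the (j+1)-st digit after the radix point.

partialSum : ∀ {m} → (ℕ → Fin m) → ℕ → ℚ
partialSum b zero    = 0ℚ
partialSum {m} b (suc n) =
  partialSum b n ℚ.+ (+ toℕ (b n) ℚ./ (m ℕ.^ suc n)) {{ℕₚ.m^n≢0 m (suc n) {{nonZeroIndex (b n)}}}}

_⟶_ : (ℕ → ℚ) → ℝ → Set
s ⟶ x = ∀ ε → 0ℚ ℚ.< ε →
  ∃[ n₀ ] ∀ n → n₀ ℕ.≤ n → fromℚ (s n ℚ.- ε) <ᵣ x × x <ᵣ fromℚ (s n ℚ.+ ε)

K : (m : ℕ) → Subset m → Pred ℝ 0ℓ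
K m D x = Σ[ b ∈ (ℕ → Fin m) ] ((∀ j → b j Subset.∈ D) × partialSum b ⟶ x)

1/_ : ℕ⁺ → ℝ
1/ a = fromℚ (+ 1 ℚ./ value a)

reciprocals : (ℕ⁺ → ℕ⁺) → Pred ℝ 0ℓ
reciprocals a x = ∃[ n ] x ≈ᵣ 1/ a n

Finite : Pred ℝ 0ℓ → Set₁
Finite P = Σ[ xs ∈ List ℝ ] ∀ x → P x ⇔ Any (x ≈ᵣ_) xs

-- The valuation of n ≥ 1 at p ≥ 2: the bound n suffices as n < p ^ n.

ν : ℕ → ℕ → ℕ
ν p n = max 0 (filter (λ k → p ℕ.^ k ∣? n) (upTo (suc n)))

primeDivisors : ℕ → List ℕ
primeDivisors n = filter (λ p → prime? p ×-dec p ∣? n) (upTo (suc n))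

rad : ℕ → ℕ
rad n = product (primeDivisors n)

-- (A , m^∞), the full m-part of A, for m ≥ 1.

mPart : ℕ → ℕ → ℕ
mPart m A = product (map (λ p → p ℕ.^ ν p A) (primeDivisors m))

mPart≢0 : ∀ m A → NonZero (mPart m A)
mPart≢0 m A = product≢0 (map⁺ (All.map
  (λ {p} (p-prime , _) → ℕₚ.m^n≢0 p (ν p A) {{prime⇒nonZero p-prime}})
  (all-filter (λ p → prime? p ×-dec p ∣? m) (upTo (suc m)))))

-- The multiplicative order of u modulo q, for coprime u, q ≥ 1: the least
-- k ≥ 1 with u ^ k ≡ 1 (mod q).  It is at most q, so that the default
-- value q of the minimum is harmless.

ord : (q u : ℕ) → ℕ
ord q u = min q (filter (λ k → q ∣? (u ℕ.^ k ℕ.∸ 1)) (map suc (upTo q)))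

Q : ℕ → ℕ⁺ → ℕ
Q m a = (value a ℕ./ mPart m (value a)) {{mPart≢0 m (value a)}}

t : ℕ → ℕ → ℕ
t m p with p ℕ.≟ 2
... | yes _ = ν 2 (m ℕ.^ 2 ℕ.∸ 1) ℕ.∸ 1
... | no  _ = ν p (m ℕ.^ ord p m ℕ.∸ 1)

c : (m : ℕ) (D : Subset m) → Subset.∣ D ∣ ℕ.< m → ℚ
c m D #D<m = (+ (2 ℕ.* (m ℕ.∸ 1)) ℚ./ 1) ℚ.* (1ℚ ℚ.⊓ #D/[m-#D])
  where
  #D/[m-#D] : ℚ
  #D/[m-#D] = (+ Subset.∣ D ∣ ℚ./ (m ℕ.∸ Subset.∣ D ∣)) {{ℕ.>-nonZero (ℕₚ.m<n⇒0<n∸m #D<m)}}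

private
  n/d>0 : ∀ n d .{{_ : NonZero d}} → 0 ℕ.< n → 0ℚ ℚ.< + n ℚ./ d
  n/d>0 (suc n) d _ = ℚₚ.positive⁻¹ _ {{ℚₚ.normalize-pos (suc n) d}}

  ⊓>0 : ∀ p q → 0ℚ ℚ.< p → 0ℚ ℚ.< q → 0ℚ ℚ.< p ℚ.⊓ q
  ⊓>0 p q 0<p 0<q with ℚₚ.⊓-sel p q
  ... | inj₁ eq = subst (0ℚ ℚ.<_) (sym eq) 0<p
  ... | inj₂ eq = subst (0ℚ ℚ.<_) (sym eq) 0<q

c-positive : ∀ m (D : Subset m) → 1 ℕ.< Subset.∣ D ∣ → (#D<m : Subset.∣ D ∣ ℕ.< m) →
  ℚ.Positive (c m D #D<m)
c-positive m D 1<#D #D<m = ℚₚ.pos*pos⇒pos u {{ℚ.positive 0<u}} (1ℚ ℚ.⊓ r)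
  {{ℚ.positive (⊓>0 1ℚ r (ℚₚ.positive⁻¹ 1ℚ) (n/d>0 _ _ {{d≢0}} (ℕₚ.<-trans (s≤s z≤n) 1<#D)))}}
  where
  d≢0 : NonZero (m ℕ.∸ Subset.∣ D ∣)
  d≢0 = ℕ.>-nonZero (ℕₚ.m<n⇒0<n∸m #D<m)
  u = + (2 ℕ.* (m ℕ.∸ 1)) ℚ./ 1
  r = (+ Subset.∣ D ∣ ℚ./ (m ℕ.∸ Subset.∣ D ∣)) {{d≢0}}
  0<u : 0ℚ ℚ.< u
  0<u = n/d>0 (2 ℕ.* (m ℕ.∸ 1)) 1 (ℕₚ.<-≤-trans (ℕₚ.m<n⇒0<n∸m (ℕₚ.<-trans 1<#D #D<m))
    (ℕₚ.m≤n*m (m ℕ.∸ 1) 2))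

{-# OPTIONS --safe #-}
module Submission where

open import Defs
open import Data.Nat
open import Data.Nat.Properties
open import Data.Nat.Divisibility
open import Data.Nat.DivMod
open import Data.Nat.Coprimality as Coprimality using (Coprime; coprime-divisor)
open import Data.Nat.Primality
open import Data.Nat.Primality.Factorisation using (factorise; module PrimeFactorisation)
open import Data.Nat.ListAction using (product)
open import Data.Nat.ListAction.Properties using (∈⇒∣product)
open import Data.Nat.Tactic.RingSolver using (solve-∀)
open import Data.Integer as ℤ using (+_)
import Data.Integer.Properties as ℤ
import Data.Integer.Tactic.RingSolver as ℤ-Solver
open import Data.Rational as ℚ using (ℚ; 0ℚ; 1ℚ; ↥_; ↧ₙ_)
import Data.Rational.Properties as ℚ
import Data.Rational.Unnormalised as ℚᵘ
import Data.Rational.Unnormalised.Properties as ℚᵘ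
open import Data.Fin as Fin using (Fin; toℕ; fromℕ<)
import Data.Fin.Properties as Fin
open import Data.Fin.Subset as Subset using (Subset; inside; outside; ∣_∣)
open import Data.Fin.Subset.Properties using (_∈?_)
open import Data.Vec using (_∷_; here; there)
open import Data.List using (List; []; _∷_; map; filter; upTo)
open import Data.List.Extrema.Nat using (argmax-sel; argmin-sel; xs≤max; min≤xs)
open import Data.List.Membership.Propositional using (_∈_; find; lose)
open import Data.List.Membership.Propositional.Properties using (∈-filter⁺; ∈-filter⁻; ∈-map⁺; ∈-map⁻; ∈-upTo⁺)
open import Data.List.Relation.Unary.All as All using (All; []; _∷_)
open import Data.List.Relation.Unary.All.Properties using (all-filter)
open import Data.List.Relation.Unary.Any using (Any)
import Data.List.Relation.Unary.Any.Properties as Any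
open import Data.List.Relation.Unary.AllPairs using ([]; _∷_)
open import Data.List.Relation.Unary.Unique.Propositional using (Unique)
import Data.List.Relation.Unary.Unique.Propositional.Properties as Unique
open import Data.Product using (∃-syntax; Σ-syntax; _×_; _,_; proj₁; proj₂)
open import Data.Sum using (_⊎_; inj₁; inj₂; [_,_]′)
open import Data.Unit using (⊤; tt)
open import Function using (_∘_; id; mk⇔)
open import Relation.Binary.Definitions using (tri<; tri≈; tri>)
open import Relation.Binary.PropositionalEquality
open import Relation.Nullary using (¬_; Dec; yes; no; contradiction)
open import Relation.Nullary.Decidable using (_×-dec_; map′)
open import Relation.Unary using (_∉_; _∩_)
open LogLemmas using (Rep; rep; Rep-frac; Rep-self; Rep-<⁻; Rep-<⁺; Rep-≤⁻; Rep-+; Rep-*; Below; Below-down; frac; module LogCut)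

-- The remainders of the long division of 1 by a in base m are the powers of m
-- modulo a, so 1/a ∈ K puts the leading digit of every m^n mod a in D.  Let x
-- be m^ord_{p₀}(m) (or m² when p₀ = 2), L the order of m modulo rad Q, and
-- Q = p₀^ν Q′ with p₀ ∤ Q′.  By lifting the exponent the powers of x^(L Q′),
-- times a power of m absorbing (a, m^∞), run through a whole progression
-- x₀ + jW modulo a = N W, with N a power of p₀ exceeding #D.  Spaced by 1/N,
-- these points have N distinct leading digits if N ≤ m, and every leading
-- digit if N ≥ m: either way more than #D of them.

-- The order modulo the radical of Q suffices because (1 + z)^n - 1 is divisible by n z as soon as
-- every prime of n divides z: multiplicities come for free. The price is the p₀-part p₀^f of L. It
-- puts p₀^(τ+f) into W, where τ is the valuation of x - 1, and leaves N = p₀^(ν(Q) - τ - f). Since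
-- c ≥ 2 #D, the hypothesis gives p₀^(ν(Q) - t - f) > 2 #D. For odd p₀, τ = t; for p₀ = 2, τ = t +
-- 1, and the 2 in 2 #D pays for the factor that N loses. A reciprocal may have two expansions, so
-- long division must admit the remainder a, which stands for a tail of digits m - 1. It cannot
-- occur once p₀ divides a, since p₀ would then divide a power of m. Finiteness asks for a list of
-- exactly the members of the intersection, so 1/a ∈ K has to be decided for the terms before n₀.
-- Remainders lie in [0 , a], so a long enough finite division repeats one and closes up to an
-- infinite division.

prime-coprime : ∀ {p n} → Prime p → p ∤ n → Coprime p n
prime-coprime p-prime p∤n (d∣p , d∣n) with prime⇒irreducible p-prime d∣p
... | inj₁ d≡1  = d≡1
... | inj₂ refl = contradiction d∣n p∤n

coprime-*ˡ : ∀ {a b n} → Coprime a n → Coprime b n → Coprime (a * b) n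
coprime-*ˡ a⊥n b⊥n {d} (d∣ab , d∣n) =
  b⊥n (coprime-divisor (λ (k∣d , k∣a) → a⊥n (k∣a , ∣-trans k∣d d∣n)) d∣ab , d∣n)

coprime-^ˡ : ∀ {a n} → Coprime a n → ∀ e → Coprime (a ^ e) n
coprime-^ˡ     a⊥n zero    = Coprimality.1-coprimeTo _
coprime-^ˡ {a} a⊥n (suc e) = coprime-*ˡ {a} a⊥n (coprime-^ˡ a⊥n e)

coprime-product : ∀ {n ps} → All (λ p → Coprime p n) ps → Coprime (product ps) n
coprime-product []                        = Coprimality.1-coprimeTo _
coprime-product {ps = p ∷ _} (p⊥n ∷ ps⊥n) = coprime-*ˡ {p} p⊥n (coprime-product ps⊥n)

coprime-*-∣ : ∀ {a b n} → Coprime a b → a ∣ n → b ∣ n → a * b ∣ n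
coprime-*-∣ {a} {b} a⊥b a∣n (divides k refl) =
  *-monoˡ-∣ b (coprime-divisor a⊥b (subst (a ∣_) (*-comm k b) a∣n))

p^e∣nu⇒p^e∣n : ∀ {p u} → Prime p → p ∤ u → ∀ e n → p ^ e ∣ n * u → p ^ e ∣ n
p^e∣nu⇒p^e∣n {p} {u} p-prime p∤u e n p^e∣nu =
  coprime-divisor (coprime-^ˡ (prime-coprime p-prime p∤u) e) (subst (p ^ e ∣_) (*-comm n u) p^e∣nu)

prime-∣-^ : ∀ {p m} → Prime p → ∀ n → p ∣ m ^ n → p ∣ m
prime-∣-^ p-prime zero    p∣1 = contradiction (subst Prime (∣1⇒≡1 p∣1) p-prime) ¬prime[1]
prime-∣-^ {m = m} p-prime (suc n) p∣ with euclidsLemma m (m ^ n) p-prime p∣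
... | inj₁ p∣m  = p∣m
... | inj₂ p∣mⁿ = prime-∣-^ p-prime n p∣mⁿ

prime>1 : ∀ {p} → Prime p → 1 < p
prime>1 {p} p-prime = nonTrivial⇒n>1 p {{prime⇒nonTrivial p-prime}}

-- Lifting the exponent

geom : ℕ → ℕ → ℕ
geom x zero    = 0
geom x (suc n) = 1 + x * geom x n

-- Bases are written `suc z`, so that x - 1 is a variable and truncated subtraction stays out of the
-- algebra.
pow≡1+geom : ∀ z n → suc z ^ n ≡ suc (z * geom (suc z) n)
pow≡1+geom z zero    = cong suc (sym (*-zeroʳ z))
pow≡1+geom z (suc n) = trans (cong (suc z *_) (pow≡1+geom z n)) (eq z (geom (suc z) n))
  where
  eq : ∀ z g → suc z * suc (z * g) ≡ suc (z * (1 + suc z * g))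
  eq = solve-∀

pow∸1≡geom : ∀ z n → suc z ^ n ∸ 1 ≡ z * geom (suc z) n
pow∸1≡geom z n = cong pred (pow≡1+geom z n)

-- The binomial coefficient n choose 2, one index behind the usual triangular numbers: the
-- coefficient of z in ((1 + z)^n - 1)/z.
tri : ℕ → ℕ
tri zero    = 0
tri (suc n) = n + tri n

tri-double : ∀ n → tri (suc n) * 2 ≡ suc n * n
tri-double zero    = refl
tri-double (suc n) = trans (eq₁ n (tri (suc n))) (trans (cong (λ x → suc n * 2 + x) (tri-double n)) (eq₂ n))
  where
  eq₁ : ∀ n t → (suc n + t) * 2 ≡ suc n * 2 + t * 2
  eq₁ = solve-∀
  eq₂ : ∀ n → suc n * 2 + suc n * n ≡ suc (suc n) * suc n
  eq₂ = solve-∀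

odd-prime∣tri : ∀ {p} → Prime p → p ≢ 2 → p ∣ tri p
odd-prime∣tri {zero}  p-prime _ = contradiction p-prime ¬prime[0]
odd-prime∣tri {suc n} p-prime p≢2
  with euclidsLemma (tri (suc n)) 2 p-prime (subst (suc n ∣_) (sym (tri-double n)) (m∣m*n n))
... | inj₁ p∣tri = p∣tri
... | inj₂ p∣2   = contradiction (≤-antisym (∣⇒≤ p∣2) (prime>1 p-prime)) p≢2

-- The binomial theorem for ((1 + z)^n - 1)/z, with all terms from z² on collected in c.
geom-expansion : ∀ z n → ∃[ c ] geom (suc z) n ≡ n + z * (tri n + z * c)
geom-expansion z zero    = 0 , sym (trans (cong (z *_) (*-zeroʳ z)) (*-zeroʳ z))
geom-expansion z (suc n) with geom-expansion z n
... | c , eq = tri n + c + z * c , trans (cong (λ g → 1 + suc z * g) eq) (ring z n (tri n) c)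
  where
  ring : ∀ z n t c → 1 + suc z * (n + z * (t + z * c)) ≡ suc n + z * ((n + t) + z * (t + c + z * c))
  ring = solve-∀

-- Modulo p the base `suc z` is 1, so the geometric sum is congruent to n.
∣geom⇒∣ : ∀ {p} z n → p ∣ z → p ∣ geom (suc z) n → p ∣ n
∣geom⇒∣ {p} z n p∣z p∣g with geom-expansion z n
... | c , eq = ∣m+n∣m⇒∣n (subst (p ∣_) (trans eq (+-comm n _)) p∣g) (∣m⇒∣m*n _ p∣z)

∣⇒∣geom : ∀ {p} z n → p ∣ z → p ∣ n → p ∣ geom (suc z) n
∣⇒∣geom {p} z n p∣z p∣n with geom-expansion z n
... | c , eq = subst (p ∣_) (sym eq) (∣m∣n⇒∣m+n p∣n (∣m⇒∣m*n _ p∣z))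

-- The hypothesis p² ∣ z * tri p is automatic for odd p, and says 4 ∣ z for p = 2.
geom-exact : ∀ {p} z → p ∣ z → p * p ∣ z * tri p → ∃[ k ] geom (suc z) p ≡ p * (1 + p * k)
geom-exact {p} z p∣z p²∣ with geom-expansion z p
... | c , eq with ∣m∣n⇒∣m+n p²∣ (∣m⇒∣m*n c (*-pres-∣ p∣z p∣z))
... | divides k eq′ = k , (begin
  geom (suc z) p               ≡⟨ eq ⟩
  p + z * (tri p + z * c)      ≡⟨ ring₁ p z (tri p) c ⟩
  p + (z * tri p + z * z * c)  ≡⟨ cong (λ n → p + n) eq′ ⟩
  p + k * (p * p)              ≡⟨ ring₂ p k ⟩
  p * (1 + p * k)              ∎)
  where
  open ≡-Reasoning
  ring₁ : ∀ p z t c → p + z * (t + z * c) ≡ p + (z * t + z * z * c)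
  ring₁ = solve-∀
  ring₂ : ∀ p k → p + k * (p * p) ≡ p * (1 + p * k)
  ring₂ = solve-∀

p∤1+pk : ∀ {p} → Prime p → ∀ k → p ∤ 1 + p * k
p∤1+pk {p} p-prime k p∣ = ¬prime[1] (subst Prime
  (∣1⇒≡1 (∣m+n∣m⇒∣n (subst (p ∣_) (+-comm 1 (p * k)) p∣) (m∣m*n k))) p-prime)

-- The upper bound ν_p((1 + z)^i - 1) ≤ ν_p(z) + ν_p(i), with divisibility by p^e in place of
-- valuations and v taking over the p-part of z. Induction on e: if p ∤ i, the geometric sum is
-- prime to p and all of p^e sits in z; if i = j p, one p is removed on both sides and j remains.
lifting-exponent : ∀ {p z v} → Prime p → p ∣ z → p * p ∣ z * tri p → (∀ e → p ^ e ∣ z → p ^ e ∣ v) →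
  ∀ e i → p ^ e ∣ suc z ^ i ∸ 1 → p ^ e ∣ v * i
lifting-exponent {p} {z} {v} p-prime p∣z p²∣ z⇒v zero    i _ = 1∣ _
lifting-exponent {p} {z} {v} p-prime p∣z p²∣ z⇒v (suc e) i p^∣ with p ∣? i
... | no p∤i = ∣m⇒∣m*n i (z⇒v (suc e) (p^e∣nu⇒p^e∣n p-prime (p∤i ∘ ∣geom⇒∣ z i p∣z) (suc e) z
                 (subst (p ^ suc e ∣_) (pow∸1≡geom z i) p^∣)))
... | yes (divides j refl) = subst (p ^ suc e ∣_) (ring v j p)
    (*-monoʳ-∣ p (lifting-exponent {v = v} p-prime p∣z p²∣ z⇒v e j
      (subst (p ^ e ∣_) (sym (pow∸1≡geom z j)) p^e∣y)))
  where
  instance p≢0 = prime⇒nonZero p-prime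
  ring : ∀ v j p → p * (v * j) ≡ v * (j * p)
  ring = solve-∀
  g = geom (suc z) j
  y = z * g
  exact = geom-exact {p} y (∣m⇒∣m*n g p∣z)
    (subst (p * p ∣_) (ring′ z (tri p) g) (∣m⇒∣m*n g p²∣))
    where
    ring′ : ∀ z t g → z * t * g ≡ z * g * t
    ring′ = solve-∀
  k = proj₁ exact
  -- Raising 1 + y = (1 + z)^j to the power p multiplies y by exactly one p, up to a factor prime to
  -- p.
  factored : suc z ^ (j * p) ∸ 1 ≡ p * y * (1 + p * k)
  factored = begin
    suc z ^ (j * p) ∸ 1    ≡⟨ cong (_∸ 1) (sym (^-*-assoc (suc z) j p)) ⟩
    (suc z ^ j) ^ p ∸ 1    ≡⟨ cong (λ x → x ^ p ∸ 1) (pow≡1+geom z j) ⟩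
    suc y ^ p ∸ 1          ≡⟨ pow∸1≡geom y p ⟩
    y * geom (suc y) p     ≡⟨ cong (y *_) (proj₂ exact) ⟩
    y * (p * (1 + p * k))  ≡⟨ ring′ y p (1 + p * k) ⟩
    p * y * (1 + p * k)    ∎
    where
    open ≡-Reasoning
    ring′ : ∀ y p u → y * (p * u) ≡ p * y * u
    ring′ = solve-∀
  p^e∣y : p ^ e ∣ y
  p^e∣y = *-cancelˡ-∣ p (p^e∣nu⇒p^e∣n p-prime (p∤1+pk p-prime k) (suc e) (p * y)
            (subst (p ^ suc e ∣_) factored p^∣))

-- Each factor p of the exponent contributes itself: p divides z, hence y = (1 + z)^n - 1, so the p
-- powers of 1 + y in the geometric sum are all 1 modulo p.
product*z∣pow∸1 : ∀ z ps → All (_∣ z) ps → product ps * z ∣ suc z ^ product ps ∸ 1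
product*z∣pow∸1 z []       []            = ∣-reflexive (trans (+-identityʳ z) (sym (*-identityʳ z)))
product*z∣pow∸1 z (p ∷ ps) (p∣z ∷ ps∣z) = subst₂ _∣_ (sym (*-assoc p n z)) (sym factored)
  (subst (p * (n * z) ∣_) (*-comm (geom (suc y) p) y)
    (*-pres-∣ (∣⇒∣geom y p (∣m⇒∣m*n g p∣z) ∣-refl)
      (subst (n * z ∣_) (pow∸1≡geom z n) (product*z∣pow∸1 z ps ps∣z))))
  where
  n = product ps
  g = geom (suc z) n
  y = z * g
  factored : suc z ^ (p * n) ∸ 1 ≡ y * geom (suc y) p
  factored = begin
    suc z ^ (p * n) ∸ 1  ≡⟨ cong (λ k → suc z ^ k ∸ 1) (*-comm p n) ⟩
    suc z ^ (n * p) ∸ 1  ≡⟨ cong (_∸ 1) (sym (^-*-assoc (suc z) n p)) ⟩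
    (suc z ^ n) ^ p ∸ 1  ≡⟨ cong (λ x → x ^ p ∸ 1) (pow≡1+geom z n) ⟩
    suc y ^ p ∸ 1        ≡⟨ pow∸1≡geom y p ⟩
    y * geom (suc y) p   ∎
    where open ≡-Reasoning

n*z∣pow∸1 : ∀ z n .{{_ : NonZero n}} → (∀ q → Prime q → q ∣ n → q ∣ z) → n * z ∣ suc z ^ n ∸ 1
n*z∣pow∸1 z n primes∣z = subst (λ k → k * z ∣ suc z ^ k ∸ 1) (sym isFactorisation)
  (product*z∣pow∸1 z factors (All.tabulate λ {q} q∈ →
    primes∣z q (All.lookup factorsPrime q∈) (subst (q ∣_) (sym isFactorisation) (∈⇒∣product q∈))))
  where open PrimeFactorisation (factorise n)

-- Valuations, radicals and orders

ν-∣ : ∀ p n → p ^ ν p n ∣ n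
ν-∣ p n with argmax-sel id 0 (filter (λ k → p ^ k ∣? n) (upTo (suc n)))
-- The maximum falls back on 0, harmless as p^0 = 1 divides n.
... | inj₁ ν≡0 = subst (λ k → p ^ k ∣ n) (sym ν≡0) (1∣ n)
... | inj₂ ν∈  = proj₂ (∈-filter⁻ (λ k → p ^ k ∣? n) {xs = upTo (suc n)} ν∈)

ν-max : ∀ {p n} k .{{_ : NonZero n}} → 1 < p → p ^ k ∣ n → k ≤ ν p n
ν-max {p} {n} k 1<p p^k∣n = All.lookup (xs≤max 0 _)
  (∈-filter⁺ (λ k → p ^ k ∣? n) (∈-upTo⁺ (m≤n⇒m≤1+n (<-≤-trans (LogLemmas.n<b^n p 1<p k) (∣⇒≤ p^k∣n)))) p^k∣n)

ν-cofactor : ∀ {p} → Prime p → ∀ n .{{_ : NonZero n}} → ∃[ u ] (n ≡ u * p ^ ν p n × p ∤ u)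
ν-cofactor {p} p-prime n with ν-∣ p n
... | divides u eq = u , eq , λ p∣u → <-irrefl refl
  (ν-max {p} {n} (suc (ν p n)) (prime>1 p-prime) (subst (p ^ suc (ν p n) ∣_) (sym eq) (*-monoˡ-∣ (p ^ ν p n) p∣u)))

primeDivisors-prime : ∀ n → All (λ p → Prime p × p ∣ n) (primeDivisors n)
primeDivisors-prime n = all-filter (λ p → prime? p ×-dec p ∣? n) (upTo (suc n))

∈-primeDivisors : ∀ {q} n .{{_ : NonZero n}} → Prime q → q ∣ n → q ∈ primeDivisors n
∈-primeDivisors n q-prime q∣n =
  ∈-filter⁺ (λ p → prime? p ×-dec p ∣? n) (∈-upTo⁺ (s≤s (∣⇒≤ q∣n))) (q-prime , q∣n)

primeDivisors-unique : ∀ n → Unique (primeDivisors n)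
primeDivisors-unique n = Unique.filter⁺ (λ p → prime? p ×-dec p ∣? n) (Unique.upTo⁺ (suc n))

∣rad : ∀ {q} n .{{_ : NonZero n}} → Prime q → q ∣ n → q ∣ rad n
∣rad n q-prime q∣n = ∈⇒∣product (∈-primeDivisors n q-prime q∣n)

rad-nonZero : ∀ n → NonZero (rad n)
rad-nonZero n = productOfPrimes≢0 (All.map proj₁ (primeDivisors-prime n))

rad-coprime : ∀ n {m} → (∀ q → Prime q → q ∣ n → q ∤ m) → Coprime (rad n) m
rad-coprime n {m} disjoint = coprime-product {m} (All.map {Q = λ q → Coprime q m}
  (λ {q} (q-prime , q∣n) → prime-coprime q-prime (disjoint q q-prime q∣n)) (primeDivisors-prime n))

primePowers-∣ : ∀ A ps → Unique ps → All Prime ps → product (map (λ p → p ^ ν p A) ps) ∣ A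
primePowers-∣ A []       []            []               = 1∣ A
primePowers-∣ A (p ∷ ps) (p∉ps ∷ uniq) (p-prime ∷ primes) =
  coprime-*-∣ (coprime-^ˡ (Coprimality.sym (go ps p∉ps primes)) (ν p A)) (ν-∣ p A) (primePowers-∣ A ps uniq primes)
  where
  go : ∀ ps → All (p ≢_) ps → All Prime ps → Coprime (product (map (λ p → p ^ ν p A) ps)) p
  go []       []         []                = Coprimality.1-coprimeTo p
  go (q ∷ ps) (p≢q ∷ p≢) (q-prime ∷ primes) = coprime-*ˡ {q ^ ν q A}
    (coprime-^ˡ (prime-coprime q-prime λ q∣p → q≢p (prime⇒irreducible p-prime q∣p)) (ν q A)) (go ps p≢ primes)
    where
    q≢p : ¬ (q ≡ 1 ⊎ q ≡ p)
    q≢p (inj₁ refl) = ¬prime[1] q-prime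
    q≢p (inj₂ q≡p)  = p≢q (sym q≡p)

mPart-∣ : ∀ m A → mPart m A ∣ A
mPart-∣ m A = primePowers-∣ A (primeDivisors m) (primeDivisors-unique m) (All.map proj₁ (primeDivisors-prime m))

-- The exponent h is the sum of the valuations. From m^h on, all powers of m vanish modulo the
-- m-part.
mPart-∣-power : ∀ m A → ∃[ h ] mPart m A ∣ m ^ h
mPart-∣-power m A = go (primeDivisors m) (All.map proj₂ (primeDivisors-prime m))
  where
  pow-∣ : ∀ {a b} → a ∣ b → ∀ k → a ^ k ∣ b ^ k
  pow-∣ a∣b zero    = ∣-refl
  pow-∣ a∣b (suc k) = *-pres-∣ a∣b (pow-∣ a∣b k)
  go : ∀ ps → All (_∣ m) ps → ∃[ h ] product (map (λ p → p ^ ν p A) ps) ∣ m ^ h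
  go []       []            = 0 , ∣-refl
  go (p ∷ ps) (p∣m ∷ ps∣m) with go ps ps∣m
  ... | h , ∣m^h = ν p A + h , subst (p ^ ν p A * product (map (λ p → p ^ ν p A) ps) ∣_)
    (sym (^-distribˡ-+-* m (ν p A) h)) (*-pres-∣ (pow-∣ p∣m (ν p A)) ∣m^h)

mPart*Q : ∀ m a → mPart m (value a) * Q m a ≡ value a
mPart*Q m a = m*[n/m]≡n {{mPart≢0 m (value a)}} (mPart-∣ m (value a))

value-nonZero : ∀ a → NonZero (value a)
value-nonZero (mkℕ⁺ (suc _)) = _

Q-nonZero : ∀ m a → NonZero (Q m a)
Q-nonZero m a = ≢-nonZero λ Q≡0 → ≢-nonZero⁻¹ (value a) {{value-nonZero a}}
  (trans (sym (mPart*Q m a)) (trans (cong (mPart m (value a) *_) Q≡0) (*-zeroʳ (mPart m (value a)))))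

-- The m-part already contains the full power of q in a; one more q in Q would exceed the valuation
-- of a.
Q-disjoint : ∀ m .{{_ : NonZero m}} a q → Prime q → q ∣ Q m a → q ∤ m
Q-disjoint m a q q-prime q∣Q q∣m = <-irrefl refl
  (ν-max {q} {value a} (suc (ν q (value a))) {{value-nonZero a}} (prime>1 q-prime)
    (subst (q ^ suc (ν q (value a)) ∣_) (trans (*-comm (Q m a) (mPart m (value a))) (mPart*Q m a))
      (*-pres-∣ q∣Q (∈⇒∣product (∈-map⁺ (λ p → p ^ ν p (value a)) (∈-primeDivisors m q-prime q∣m))))))

%≡⇒∣∸ : ∀ x y n .{{_ : NonZero n}} → x % n ≡ y % n → n ∣ y ∸ x
%≡⇒∣∸ x y n eq = subst (n ∣_) (sym (begin
  y ∸ x                                      ≡⟨ cong₂ _∸_ (m≡m%n+[m/n]*n y n) (m≡m%n+[m/n]*n x n) ⟩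
  (y % n + y / n * n) ∸ (x % n + x / n * n)  ≡⟨ cong (λ r → (y % n + y / n * n) ∸ (r + x / n * n)) eq ⟩
  (y % n + y / n * n) ∸ (y % n + x / n * n)  ≡⟨ [m+n]∸[m+o]≡n∸o (y % n) _ _ ⟩
  y / n * n ∸ x / n * n                      ≡⟨ sym (*-distribʳ-∸ n (y / n) (x / n)) ⟩
  (y / n ∸ x / n) * n                        ∎)) (n∣m*n (y / n ∸ x / n))
  where open ≡-Reasoning

x*y∸x : ∀ x y → x * y ∸ x ≡ x * (y ∸ 1)
x*y∸x x y = trans (cong (x * y ∸_) (sym (*-identityʳ x))) (sym (*-distribˡ-∸ x y 1))

-- Two of the q + 1 powers u^0, ..., u^q agree modulo q, and the smaller one is cancelled because it
-- is prime to q. The exponent `suc k` is at most q, inside the search range of `ord`.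
power-repeats : ∀ q u .{{_ : NonZero q}} → Coprime q u →
  ∃[ k ] (k < q × q ∣ u ^ suc k ∸ 1)
power-repeats q u q⊥u with Fin.pigeonhole (n<1+n q) (λ i → fromℕ< (m%n<n (u ^ toℕ i) q))
... | i , j , i<j , eq = k , ≤-trans (subst (suc k ≤_) (m+[n∸m]≡n i<j) (s≤s (m≤n+m k (toℕ i)))) (s≤s⁻¹ (Fin.toℕ<n j))
  , coprime-divisor (Coprimality.sym (coprime-^ˡ (Coprimality.sym q⊥u) (toℕ i)))
      (subst (q ∣_) (trans (cong (_∸ u ^ toℕ i) split) (x*y∸x (u ^ toℕ i) (u ^ suc k)))
        (%≡⇒∣∸ (u ^ toℕ i) (u ^ toℕ j) q (begin
          u ^ toℕ i % q  ≡⟨ sym (Fin.toℕ-fromℕ< _) ⟩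
          _              ≡⟨ cong toℕ eq ⟩
          _              ≡⟨ Fin.toℕ-fromℕ< _ ⟩
          u ^ toℕ j % q  ∎)))
  where
  open ≡-Reasoning
  k = toℕ j ∸ suc (toℕ i)
  split : u ^ toℕ j ≡ u ^ toℕ i * u ^ suc k
  split = trans (cong (u ^_) (sym (trans (+-suc (toℕ i) k) (m+[n∸m]≡n i<j)))) (^-distribˡ-+-* u (toℕ i) (suc k))

ord-spec : ∀ q u .{{_ : NonZero q}} → Coprime q u → NonZero (ord q u) × q ∣ u ^ ord q u ∸ 1
ord-spec q u q⊥u with power-repeats q u q⊥u
... | k , k<q , q∣ with argmin-sel id q (filter (λ k → q ∣? (u ^ k ∸ 1)) (map suc (upTo q)))
... | inj₂ ord∈ with ∈-filter⁻ (λ k → q ∣? (u ^ k ∸ 1)) {xs = map suc (upTo q)} ord∈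
...   | ord∈′ , q∣′ with ∈-map⁻ suc ord∈′
...     | _ , _ , eq = subst NonZero (sym eq) _ , q∣′
-- If the minimum takes its default q, the exponent `suc k` ≤ q found by pigeonhole is still in the
-- list, so it equals q.
ord-spec q u q⊥u | k , k<q , q∣ | inj₁ ord≡q = subst NonZero (sym ord≡1+k) _
    , subst (λ k → q ∣ u ^ k ∸ 1) (sym ord≡1+k) q∣
  where
  ord≡1+k : ord q u ≡ suc k
  ord≡1+k = ≤-antisym (All.lookup (min≤xs q _)
    (∈-filter⁺ (λ k → q ∣? (u ^ k ∸ 1)) (∈-map⁺ suc (∈-upTo⁺ k<q)) q∣)) (subst (suc k ≤_) (sym ord≡q) k<q)

-- Filling a residue class with powers of m

Fin-injective⇒surjective : ∀ {n} (f : Fin n → Fin n) → (∀ {i j} → f i ≡ f j → i ≡ j) → ∀ j → ∃[ i ] f i ≡ j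
Fin-injective⇒surjective {suc n} f f-inj j with Fin.any? (λ i → f i Fin.≟ j)
... | yes hit = hit
... | no miss = contradiction (Fin.injective⇒≤ {f = λ i → Fin.punchOut (avoid i)}
    (λ {i} {k} eq → f-inj (Fin.punchOut-injective (avoid i) (avoid k) eq))) 1+n≰n
  where
  avoid : ∀ i → j ≢ f i
  avoid i j≡fi = miss (i , sym j≡fi)

-- Modulo N W the class of x modulo W has exactly the N lifts x + j W. The quotients of the residues
-- by W form an injective self-map of `Fin N`, so every j occurs.
class-filled : ∀ {N W x} (g : ℕ → ℕ) .{{_ : NonZero W}} .{{_ : NonZero (N * W)}} →
  (∀ i → g i % W ≡ x) → (∀ i j → i < j → j < N → g i % (N * W) ≢ g j % (N * W)) →
  ∀ j → j < N → ∃[ i ] g i % (N * W) ≡ x + j * W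
class-filled {N} {W} {x} g g≡x distinct j j<N = toℕ i
  , trans (split (toℕ i)) (cong (λ k → x + k * W)
      (trans (sym (Fin.toℕ-fromℕ< _)) (trans (cong toℕ (proj₂ found)) (Fin.toℕ-fromℕ< j<N))))
  where
  r : ℕ → ℕ
  r i = g i % (N * W)
  split : ∀ i → r i ≡ x + r i / W * W
  split i = trans (m≡m%n+[m/n]*n (r i) W)
    (cong (_+ r i / W * W) (trans (m∣n⇒o%n%m≡o%m W (N * W) (g i) (n∣m*n N)) (g≡x i)))
  φ : Fin N → Fin N
  φ i = fromℕ< (m<n*o⇒m/o<n {r (toℕ i)} {N} {W} (m%n<n (g (toℕ i)) (N * W)))
  φ-inj : ∀ {i k} → φ i ≡ φ k → i ≡ k
  φ-inj {i} {k} eq with Fin.<-cmp i k | trans (split (toℕ i)) (trans (cong (λ t → x + t * W)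
    (trans (sym (Fin.toℕ-fromℕ< _)) (trans (cong toℕ eq) (Fin.toℕ-fromℕ< _)))) (sym (split (toℕ k))))
  ... | tri< i<k _ _ | r≡ = contradiction r≡ (distinct (toℕ i) (toℕ k) i<k (Fin.toℕ<n k))
  ... | tri≈ _ i≡k _ | _  = i≡k
  ... | tri> _ _ k<i | r≡ = contradiction (sym r≡) (distinct (toℕ k) (toℕ i) k<i (Fin.toℕ<n i))
  found = Fin-injective⇒surjective φ φ-inj (fromℕ< j<N)
  i = proj₁ found

y∸1∣y^k∸1 : ∀ y k → y ∸ 1 ∣ y ^ k ∸ 1
y∸1∣y^k∸1 zero    zero    = ∣-refl
y∸1∣y^k∸1 zero    (suc k) = ∣-refl
y∸1∣y^k∸1 (suc z) k       = subst (z ∣_) (sym (pow∸1≡geom z k)) (m∣m*n (geom (suc z) k))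

x^n∸1∣x^nk∸1 : ∀ x n k → x ^ n ∸ 1 ∣ x ^ (n * k) ∸ 1
x^n∸1∣x^nk∸1 x n k = subst (λ y → x ^ n ∸ 1 ∣ y ∸ 1) (^-*-assoc x n k) (y∸1∣y^k∸1 (x ^ n) k)

^-monoʳ-∣ : ∀ p {i j} → i ≤ j → p ^ i ∣ p ^ j
^-monoʳ-∣ p {i} {j} i≤j = subst (p ^ i ∣_)
  (trans (sym (^-distribˡ-+-* p i (j ∸ i))) (cong (p ^_) (m+[n∸m]≡n i≤j))) (m∣m*n (p ^ (j ∸ i)))

-- In the application τ is the valuation of z, u p^f is the order of m modulo rad Q, A is the m-part
-- of a, and q is the part of Q prime to p. Then a = A q p^(τ+f+k) = N W.
module Orbit (m : ℕ) .{{_ : NonZero m}} {p : ℕ} (p-prime : Prime p) (p∤m : p ∤ m)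
  (z o τ : ℕ) (m^o≡1+z : m ^ o ≡ suc z) (p∣z : p ∣ z) (p²∣ : p * p ∣ z * tri p)
  (p^τ∣z : p ^ τ ∣ z) (τ-max : ∀ i → p ^ i ∣ z → i ≤ τ)
  (A h q u f k : ℕ) .{{A≢0 : NonZero A}} .{{q≢0 : NonZero q}} (A∣m^h : A ∣ m ^ h)
  (p∤q : p ∤ q) (p∤u : p ∤ u) (primes∣ : ∀ r → Prime r → r ∣ q → r ∣ m ^ (u * p ^ f) ∸ 1)
  where

  ℓ M W N : ℕ
  ℓ = u * p ^ f
  M = ℓ * q
  W = A * (q * p ^ (τ + f))
  N = p ^ k

  instance
    p≢0 : NonZero p
    p≢0 = prime⇒nonZero p-prime
    W≢0 : NonZero W
    W≢0 = m*n≢0 A (q * p ^ (τ + f)) {{A≢0}} {{m*n≢0 q (p ^ (τ + f)) {{q≢0}} {{m^n≢0 p (τ + f)}}}}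
    N*W≢0 : NonZero (N * W)
    N*W≢0 = m*n≢0 N W {{m^n≢0 p k}} {{W≢0}}

  w : ℕ
  w = z * geom (suc z) ℓ

  -- With x = 1 + z, `w` is x^ℓ - 1. The power x^(p^f) gains p^f over z, and p^f divides ℓ.
  p^[τ+f]∣w : p ^ (τ + f) ∣ w
  p^[τ+f]∣w = subst (p ^ (τ + f) ∣_) (pow∸1≡geom z ℓ) (∣-trans (∣-trans
    (subst (_∣ p ^ f * z) (trans (*-comm (p ^ f) (p ^ τ)) (sym (^-distribˡ-+-* p τ f))) (*-monoʳ-∣ (p ^ f) p^τ∣z))
    (n*z∣pow∸1 z (p ^ f) {{m^n≢0 p f}} prime-divisor))
    (subst (λ n → suc z ^ (p ^ f) ∸ 1 ∣ suc z ^ n ∸ 1) (*-comm (p ^ f) u)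
      (x^n∸1∣x^nk∸1 (suc z) (p ^ f) u)))
    where
    prime-divisor : ∀ r → Prime r → r ∣ p ^ f → r ∣ z
    prime-divisor r r-prime r∣p^f with prime⇒irreducible p-prime (prime-∣-^ r-prime f r∣p^f)
    ... | inj₁ refl = contradiction r-prime ¬prime[1]
    ... | inj₂ refl = p∣z

  m^ℓ∸1∣w : m ^ ℓ ∸ 1 ∣ w
  m^ℓ∸1∣w = subst (m ^ ℓ ∸ 1 ∣_)
    (trans (cong (_∸ 1) (trans (cong (m ^_) (*-comm ℓ o)) (trans (sym (^-*-assoc m o ℓ)) (cong (_^ ℓ) m^o≡1+z))))
      (pow∸1≡geom z ℓ))
    (x^n∸1∣x^nk∸1 m ℓ o)

  -- x^M is the q-th power of 1 + w. Every prime of q divides m^ℓ - 1, hence w, so this power gains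
  -- the factor q over w.
  qp^[τ+f]∣ : q * p ^ (τ + f) ∣ suc z ^ M ∸ 1
  qp^[τ+f]∣ = subst (q * p ^ (τ + f) ∣_)
    (cong (_∸ 1) (trans (cong (_^ q) (sym (pow≡1+geom z ℓ))) (^-*-assoc (suc z) ℓ q)))
    (∣-trans (*-monoʳ-∣ q p^[τ+f]∣w)
      (n*z∣pow∸1 w q λ r r-prime r∣q → ∣-trans (primes∣ r r-prime r∣q) m^ℓ∸1∣w))

  g : ℕ → ℕ
  g i = m ^ (h + o * (M * i))

  g-+ : ∀ i d → g (i + d) ≡ g i * suc z ^ (M * d)
  g-+ i d = begin
    m ^ (h + o * (M * (i + d)))                  ≡⟨ cong (m ^_) (ring h o M i d) ⟩
    m ^ ((h + o * (M * i)) + o * (M * d))        ≡⟨ ^-distribˡ-+-* m (h + o * (M * i)) (o * (M * d)) ⟩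
    g i * m ^ (o * (M * d))                      ≡⟨ cong (g i *_) (sym (^-*-assoc m o (M * d))) ⟩
    g i * (m ^ o) ^ (M * d)                      ≡⟨ cong (λ x → g i * x ^ (M * d)) m^o≡1+z ⟩
    g i * suc z ^ (M * d)                        ∎
    where
    open ≡-Reasoning
    ring : ∀ h o M i d → h + o * (M * (i + d)) ≡ (h + o * (M * i)) + o * (M * d)
    ring = solve-∀

  -- Passing from 0 to i adds m^h (x^(M i) - 1): A divides the first factor, q p^(τ+f) the second.
  g-class : ∀ i → g i % W ≡ g 0 % W
  g-class i = trans (cong (_% W) (trans (g-+ 0 i) (trans (cong (g 0 *_) (pow≡1+geom z (M * i))) (*-suc (g 0) _))))
    (%-remove-+ʳ (g 0) (subst (λ y → W ∣ g 0 * y) (pow∸1≡geom z (M * i))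
      (*-pres-∣ (∣-trans A∣m^h (^-monoʳ-∣ m (m≤m+n h _)))
        (∣-trans qp^[τ+f]∣ (x^n∸1∣x^nk∸1 (suc z) M i)))))

  -- A coincidence makes p^(τ+f+k) divide x^(M d) - 1 with d = j - i, powers of m being prime to p.
  -- Lifting the exponent turns this into p^(τ+f+k) ∣ p^τ M d; as M has p-part p^f, it follows that
  -- p^k ∣ d, impossible for 0 < d < N.
  g-distinct : ∀ i j → i < j → j < N → g i % (N * W) ≢ g j % (N * W)
  g-distinct i j i<j j<N eq = <-irrefl refl (<-≤-trans (≤-<-trans (m∸n≤m j i) j<N)
    (∣⇒≤ {{>-nonZero (m<n⇒0<n∸m i<j)}} N∣d))
    where
    d = j ∸ i
    e = τ + f + k
    a∣ : N * W ∣ (suc z ^ (M * d) ∸ 1) * g i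
    a∣ = subst (N * W ∣_) (trans (cong (_∸ g i) (trans (cong g (sym (m+[n∸m]≡n (<⇒≤ i<j)))) (g-+ i d)))
      (trans (x*y∸x (g i) (suc z ^ (M * d))) (*-comm (g i) (suc z ^ (M * d) ∸ 1)))) (%≡⇒∣∸ (g i) (g j) (N * W) eq)
    p^e∣a : p ^ e ∣ N * W
    p^e∣a = divides (A * q) (trans (ring N A q (p ^ (τ + f))) (cong (A * q *_) (sym (^-distribˡ-+-* p (τ + f) k))))
      where
      ring : ∀ N A q e → N * (A * (q * e)) ≡ A * q * (e * N)
      ring = solve-∀
    lifted : p ^ e ∣ p ^ τ * (M * d)
    lifted = lifting-exponent {v = p ^ τ} p-prime p∣z p²∣ (λ i p^i∣z → ^-monoʳ-∣ p (τ-max i p^i∣z)) e (M * d)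
      (p^e∣nu⇒p^e∣n p-prime (p∤m ∘ prime-∣-^ p-prime (h + o * (M * i))) e (suc z ^ (M * d) ∸ 1) (∣-trans p^e∣a a∣))
    regroup : p ^ τ * (M * d) ≡ p ^ (τ + f) * d * (u * q)
    regroup = trans (ring (p ^ τ) u (p ^ f) q d) (cong (λ t → t * d * (u * q)) (sym (^-distribˡ-+-* p τ f)))
      where
      ring : ∀ t u f q d → t * (u * f * q * d) ≡ t * f * d * (u * q)
      ring = solve-∀
    p∤uq : p ∤ u * q
    p∤uq p∣ with euclidsLemma u q p-prime p∣
    ... | inj₁ p∣u = p∤u p∣u
    ... | inj₂ p∣q = p∤q p∣q
    N∣d : N ∣ d
    N∣d = *-cancelˡ-∣ (p ^ (τ + f)) {{m^n≢0 p (τ + f)}}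
      (subst (_∣ p ^ (τ + f) * d) (^-distribˡ-+-* p (τ + f) k)
        (p^e∣nu⇒p^e∣n p-prime p∤uq e (p ^ (τ + f) * d) (subst (p ^ e ∣_) regroup lifted)))

  orbit : ∀ j → j < N → ∃[ n ] m ^ n % (N * W) ≡ g 0 % W + j * W
  orbit j j<N = h + o * (M * proj₁ filled) , proj₂ filled
    where filled = class-filled {N} {W} {g 0 % W} g g-class g-distinct j j<N

-- Leading digits of equally spaced points

rank : ∀ {n} {D : Subset n} {x} → x Subset.∈ D → Fin ∣ D ∣
rank                        here        = Fin.zero
rank {D = inside  ∷ _} (there x∈D) = Fin.suc (rank x∈D)
rank {D = outside ∷ _} (there x∈D) = rank x∈D

rank-injective : ∀ {n} {D : Subset n} {x y} (x∈D : x Subset.∈ D) (y∈D : y Subset.∈ D) →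
  rank x∈D ≡ rank y∈D → x ≡ y
rank-injective                   here        here        _  = refl
rank-injective {D = inside ∷ _}  here        (there _)   ()
rank-injective {D = inside ∷ _}  (there _)   here        ()
rank-injective {D = inside ∷ _}  (there x∈D) (there y∈D) eq = cong Fin.suc (rank-injective x∈D y∈D (Fin.suc-injective eq))
rank-injective {D = outside ∷ _} (there x∈D) (there y∈D) eq = cong Fin.suc (rank-injective x∈D y∈D eq)

injection⇒≤∣D∣ : ∀ {N n} {D : Subset n} (f : Fin N → Fin n) → (∀ {i j} → f i ≡ f j → i ≡ j) →
  (∀ i → f i Subset.∈ D) → N ≤ ∣ D ∣
injection⇒≤∣D∣ f f-inj f∈D = Fin.injective⇒≤ {f = λ i → rank (f∈D i)}
  (λ {i} {j} eq → f-inj (rank-injective (f∈D i) (f∈D j) eq))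

-- The quotient of y by a, stated without division. For y = m r with r < a it is the leading base-m
-- digit of r/a.
IsDigit : ℕ → ℕ → ℕ → Set
IsDigit a y d = d * a ≤ y × y < suc d * a

isDigit-unique : ∀ {a y d d′} → IsDigit a y d → IsDigit a y d′ → d ≡ d′
isDigit-unique {a} {y} {d} {d′} (d≤ , <d) (d′≤ , <d′) = ≤-antisym
  (s≤s⁻¹ (*-cancelʳ-< a d (suc d′) (≤-<-trans d≤ <d′)))
  (s≤s⁻¹ (*-cancelʳ-< a d′ (suc d) (≤-<-trans d′≤ <d)))

-- A digit stands for a half-open interval of length 1/m. If 1/N ≥ 1/m, no interval holds two
-- points; if 1/N ≤ 1/m, no interval is jumped over, so D contains every digit.
spaced-digits : ∀ {m N W x} (D : Subset m) .{{_ : NonZero m}} .{{_ : NonZero W}} → x < W →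
  (∀ j → j < N → ∃[ d ] (d Subset.∈ D × IsDigit (N * W) (m * (x + j * W)) (toℕ d))) →
  N ≤ ∣ D ∣ ⊎ m ≤ ∣ D ∣
spaced-digits {m} {N} {W} {x} D x<W digit with ≤-total N m
... | inj₁ N≤m = inj₁ (injection⇒≤∣D∣ dig dig-inj (λ i → proj₁ (proj₂ (digit (toℕ i) (Fin.toℕ<n i)))))
  where
  dig : Fin N → Fin m
  dig i = proj₁ (digit (toℕ i) (Fin.toℕ<n i))
  isDig : ∀ i → IsDigit (N * W) (m * (x + toℕ i * W)) (toℕ (dig i))
  isDig i = proj₂ (proj₂ (digit (toℕ i) (Fin.toℕ<n i)))
  dig-< : ∀ {i j} → toℕ i < toℕ j → dig i ≢ dig j
  dig-< {i} {j} i<j eq = <⇒≱ (subst (λ d → m * (x + toℕ j * W) < suc (toℕ d) * (N * W)) (sym eq) (proj₂ (isDig j)))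
    (begin
      N * W + toℕ (dig i) * (N * W)    ≤⟨ +-mono-≤ (*-monoˡ-≤ W N≤m) (proj₁ (isDig i)) ⟩
      m * W + m * (x + toℕ i * W)      ≡⟨ ring m W x (toℕ i) ⟩
      m * (x + suc (toℕ i) * W)        ≤⟨ *-monoʳ-≤ m (+-monoʳ-≤ x (*-monoˡ-≤ W i<j)) ⟩
      m * (x + toℕ j * W)              ∎)
    where
    open ≤-Reasoning
    ring : ∀ m W x i → m * W + m * (x + i * W) ≡ m * (x + suc i * W)
    ring = solve-∀
  dig-inj : ∀ {i j} → dig i ≡ dig j → i ≡ j
  dig-inj {i} {j} eq with Fin.<-cmp i j
  ... | tri< i<j _ _ = contradiction eq (dig-< i<j)
  ... | tri≈ _ i≡j _ = i≡j
  ... | tri> _ _ j<i = contradiction (sym eq) (dig-< j<i)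
... | inj₂ m≤N = inj₂ (injection⇒≤∣D∣ id id attained)
  where
  y : ℕ → ℕ
  y j = m * (x + j * W)
  mW≤a : m * W ≤ N * W
  mW≤a = *-monoˡ-≤ W m≤N
  hit : ∀ d → d < m → ∃[ j ] IsDigit (N * W) (y j) d
  hit d d<m with y 0 <? d * (N * W)
  -- The first point is not left of the interval, and x < W keeps it below 1/m.
  ... | no  y≮ = 0 , ≮⇒≥ y≮ , (begin-strict
      m * (x + 0)      <⟨ *-monoʳ-< m (subst (_< W) (sym (+-identityʳ x)) x<W) ⟩
      m * W            ≤⟨ mW≤a ⟩
      N * W            ≤⟨ m≤m+n (N * W) _ ⟩
      suc d * (N * W)  ∎)
    where open ≤-Reasoning
  -- The step that crosses the left end of the interval lands inside, a gap being at most the length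
  -- of the interval.
  ... | yes y< with LogLemmas.last y (d * (N * W)) N y< (begin
      d * (N * W)      ≤⟨ *-monoˡ-≤ (N * W) (<⇒≤ d<m) ⟩
      m * (N * W)      ≤⟨ *-monoʳ-≤ m (m≤n+m (N * W) x) ⟩
      m * (x + N * W)  ∎)
    where open ≤-Reasoning
  ...   | j , lo , hi = suc j , hi , (begin-strict
      m * (x + suc j * W)      ≡⟨ ring m W x j ⟩
      m * W + m * (x + j * W)  <⟨ +-mono-≤-< mW≤a lo ⟩
      N * W + d * (N * W)      ∎)
    where
    open ≤-Reasoning
    ring : ∀ m W x j → m * (x + suc j * W) ≡ m * W + m * (x + j * W)
    ring = solve-∀
  attained : ∀ d → d Subset.∈ D
  attained d with hit (toℕ d) (Fin.toℕ<n d)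
  -- The index from `hit` comes without a bound; j < N because its point lies below (d + 1)/m ≤ 1.
  ... | j , isDig with digit j (*-cancelʳ-< W j N (≤-<-trans (m≤n+m (j * W) x)
      (*-cancelˡ-< m _ _ (<-≤-trans (proj₂ isDig) (*-monoˡ-≤ (N * W) (Fin.toℕ<n d))))))
  ...   | d′ , d′∈D , isDig′ = subst (Subset._∈ D) (Fin.toℕ-injective (isDigit-unique isDig′ isDig)) d′∈D

-- Cuts and base-m expansions

Rep-≤⁺ : ∀ {q r} i j e i′ j′ e′ .{{_ : NonZero e}} .{{_ : NonZero e′}} →
  Rep q i j e → Rep r i′ j′ e′ → i * e′ + j′ * e ≤ i′ * e + j * e′ → q ℚ.≤ r
Rep-≤⁺ {q} {r} i j e i′ j′ e′ q≃ r≃ le = ℚ.≮⇒≥ λ r<q →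
  <⇒≱ (Rep-<⁻ {r} {q} i′ j′ e′ i j e r≃ q≃ r<q) le

Rep-/ : ∀ n e .{{_ : NonZero e}} → Rep (+ n ℚ./ e) n 0 e
Rep-/ n e = subst (λ i → Rep (i ℚ./ e) n 0 e) (ℤ.+-identityʳ (+ n)) (Rep-frac n 0 e)

Rep-scale : ∀ {q} k i e .{{_ : NonZero k}} .{{_ : NonZero e}} .{{_ : NonZero (k * e)}} →
  Rep q i 0 e → Rep q (k * i) 0 (k * e)
Rep-scale k@(suc _) i e@(suc _) (rep q≃) = rep (ℚᵘ.≃-trans q≃ (ℚᵘ.*≡* (begin
  (+ i ℤ.- + 0) ℤ.* + (k * e)        ≡⟨ cong₂ ℤ._*_ (ℤ.+-identityʳ (+ i)) (ℤ.pos-* k e) ⟩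
  + i ℤ.* (+ k ℤ.* + e)              ≡⟨ ring (+ i) (+ k) (+ e) ⟩
  (+ k ℤ.* + i) ℤ.* + e              ≡⟨ cong (ℤ._* + e) (sym (trans (ℤ.+-identityʳ _) (ℤ.pos-* k i))) ⟩
  (+ (k * i) ℤ.- + 0) ℤ.* + e        ∎)))
  where
  open ≡-Reasoning
  ring : ∀ i k e → i ℤ.* (k ℤ.* e) ≡ (k ℤ.* i) ℤ.* e
  ring = ℤ-Solver.solve-∀

p-q+q≡p : ∀ p q → (p ℚ.- q) ℚ.+ q ≡ p
p-q+q≡p p q = trans (ℚ.+-assoc p (ℚ.- q) q) (trans (cong (p ℚ.+_) (ℚ.+-inverseˡ q)) (ℚ.+-identityʳ p))

p<q⇒0<q-p : ∀ {p q} → p ℚ.< q → 0ℚ ℚ.< q ℚ.- p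
p<q⇒0<q-p {p} {q} p<q = subst (ℚ._< q ℚ.- p) (ℚ.+-inverseʳ p) (ℚ.+-monoˡ-< (ℚ.- p) p<q)

q+[p-q]≡p : ∀ p q → q ℚ.+ (p ℚ.- q) ≡ p
q+[p-q]≡p p q = trans (ℚ.+-comm q (p ℚ.- q)) (p-q+q≡p p q)

p-q<r⇒p<r+q : ∀ p q r → p ℚ.- q ℚ.< r → p ℚ.< r ℚ.+ q
p-q<r⇒p<r+q p q r lt = subst (ℚ._< r ℚ.+ q) (p-q+q≡p p q) (ℚ.+-monoˡ-< q lt)

p-q<p : ∀ p q → 0ℚ ℚ.< q → p ℚ.- q ℚ.< p
p-q<p p q 0<q = subst (p ℚ.- q ℚ.<_) (p-q+q≡p p q)
  (subst (ℚ._< p ℚ.- q ℚ.+ q) (ℚ.+-identityʳ (p ℚ.- q)) (ℚ.+-monoʳ-< (p ℚ.- q) 0<q))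

+-cancelʳ-<ℚ : ∀ {p q} r → p ℚ.+ r ℚ.< q ℚ.+ r → p ℚ.< q
+-cancelʳ-<ℚ r lt = ℚ.≰⇒> λ q≤p → ℚ.<-irrefl refl (ℚ.<-≤-trans lt (ℚ.+-monoˡ-≤ r q≤p))

fromℚ-<⁻ : ∀ {p q} → fromℚ p <ᵣ fromℚ q → p ℚ.< q
fromℚ-<⁻ (_ , p<r , r<q) = ℚ.<-trans p<r r<q

fromℚ-<⁺ : ∀ {p q} → p ℚ.< q → fromℚ p <ᵣ fromℚ q
fromℚ-<⁺ p<q = let (r , p<r , r<q) = ℚ.<-dense p<q in r , p<r , r<q

-- `_≤ᵣ_` compares lower cuts only. To carry q over to the upper cut of y, open it to r < q and
-- locate y within q - r: the lower approximation s is below x, hence below r, so s + (q - r) < q.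
≤ᵣ⇒U : ∀ x y → y ≤ᵣ x → ∀ {q} → U x q → U y q
≤ᵣ⇒U x y y≤x {q} Uq with U-open x Uq
... | r , r<q , Ur with located y (q ℚ.- r) (p<q⇒0<q-p r<q)
...   | s , Ls , Us = U-up y (subst (s ℚ.+ (q ℚ.- r) ℚ.<_) (q+[p-q]≡p q r)
  (ℚ.+-monoˡ-< (q ℚ.- r) (L<U x (y≤x s Ls) Ur))) Us

⟶-resp-≈ : ∀ s x y → x ≈ᵣ y → s ⟶ x → s ⟶ y
⟶-resp-≈ s x y (x≤y , y≤x) s⟶x ε 0<ε with s⟶x ε 0<ε
... | n₀ , close = n₀ , λ n n₀≤n → let ((q , <q , Lq) , (r , Ur , r<)) = close n n₀≤n in
  (q , <q , x≤y q Lq) , (r , ≤ᵣ⇒U x y y≤x Ur , r<)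

module Expansion {m : ℕ} (b : ℕ → Fin m) (m>1 : 1 < m) where

  instance
    m≢0 : NonZero m
    m≢0 = >-nonZero (<-trans (s≤s z≤n) m>1)

  numerator : ℕ → ℕ
  numerator zero    = 0
  numerator (suc n) = m * numerator n + toℕ (b n)

  1/m^ : ℕ → ℚ
  1/m^ n = (+ 1 ℚ./ (m ^ n)) {{m^n≢0 m n}}

  -- Right end of the interval of numbers that begin with the first n digits of b; these intervals
  -- are nested.
  upper : ℕ → ℚ
  upper n = (+ suc (numerator n) ℚ./ (m ^ n)) {{m^n≢0 m n}}

  OverPow : ℚ → ℕ → ℕ → Set
  OverPow q i n = Rep q i 0 (m ^ n) {{m^n≢0 m n}}

  OverPow-/ : ∀ i n → OverPow ((+ i ℚ./ (m ^ n)) {{m^n≢0 m n}}) i n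
  OverPow-/ i n = Rep-/ i (m ^ n) {{m^n≢0 m n}}

  OverPow-+ : ∀ {q r} i i′ n → OverPow q i n → OverPow r i′ n → OverPow (q ℚ.+ r) (i + i′) n
  OverPow-+ {q} {r} i i′ n = Rep-+ {q} {r} i 0 (m ^ n) i′ 0 {{m^n≢0 m n}}

  OverPow-≤ : ∀ {q r} i n i′ n′ → OverPow q i n → OverPow r i′ n′ → i * m ^ n′ ≤ i′ * m ^ n → q ℚ.≤ r
  OverPow-≤ {q} {r} i n i′ n′ q≃ r≃ le =
    Rep-≤⁺ {q} {r} i 0 (m ^ n) i′ 0 (m ^ n′) {{m^n≢0 m n}} {{m^n≢0 m n′}} q≃ r≃ (+-monoˡ-≤ 0 le)

  Rep-partialSum : ∀ n → OverPow (partialSum b n) (numerator n) n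
  Rep-partialSum zero    = Rep-/ 0 1
  Rep-partialSum (suc n) = OverPow-+ {partialSum b n} (m * numerator n) (toℕ (b n)) (suc n)
    (Rep-scale {partialSum b n} m (numerator n) (m ^ n) {{m≢0}} {{m^n≢0 m n}} {{m^n≢0 m (suc n)}} (Rep-partialSum n))
    (OverPow-/ (toℕ (b n)) (suc n))

  Rep-upper : ∀ n → OverPow (upper n) (suc (numerator n)) n
  Rep-upper n = OverPow-/ (suc (numerator n)) n

  partialSum-mono : ∀ d n → partialSum b n ℚ.≤ partialSum b (d + n)
  partialSum-mono zero    n = ℚ.≤-refl
  partialSum-mono (suc d) n = ℚ.≤-trans (partialSum-mono d n)
    (OverPow-≤ (numerator k) k (numerator (suc k)) (suc k) (Rep-partialSum k) (Rep-partialSum (suc k))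
      (subst (_≤ numerator (suc k) * m ^ k) (ring (numerator k) m (m ^ k))
        (*-monoˡ-≤ (m ^ k) (m≤m+n (m * numerator k) (toℕ (b k))))))
    where
    k = d + n
    ring : ∀ s m p → m * s * p ≡ s * (m * p)
    ring = solve-∀

  upper-antitone : ∀ d n → upper (d + n) ℚ.≤ upper n
  upper-antitone zero    n = ℚ.≤-refl
  upper-antitone (suc d) n = ℚ.≤-trans
    (OverPow-≤ (suc (numerator (suc k))) (suc k) (suc (numerator k)) k (Rep-upper (suc k)) (Rep-upper k)
      (subst (suc (numerator (suc k)) * m ^ k ≤_) (ring (numerator k) m (m ^ k))
        (*-monoˡ-≤ (m ^ k) (subst (_≤ m * numerator k + m) (+-suc (m * numerator k) (toℕ (b k)))
          (+-monoʳ-≤ (m * numerator k) (Fin.toℕ<n (b k)))))))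
    (upper-antitone d n)
    where
    k = d + n
    ring : ∀ s m p → (m * s + m) * p ≡ suc s * (m * p)
    ring = solve-∀

  partialSum≤upper : ∀ n → partialSum b n ℚ.≤ upper n
  partialSum≤upper n = OverPow-≤ (numerator n) n (suc (numerator n)) n (Rep-partialSum n) (Rep-upper n)
    (*-monoˡ-≤ (m ^ n) (n≤1+n (numerator n)))

  module _ (a : ℕ) .{{_ : NonZero a}} where

    <1/a : ∀ {q} i n → OverPow q i n → i * a < m ^ n → q ℚ.< + 1 ℚ./ a
    <1/a {q} i n q≃ lt = Rep-<⁺ {q} {+ 1 ℚ./ a} i 0 (m ^ n) 1 0 a {{m^n≢0 m n}} q≃ (Rep-/ 1 a)
      (+-monoˡ-< 0 (subst (i * a <_) (sym (+-identityʳ (m ^ n))) lt))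

    1/a< : ∀ {q} i n → OverPow q i n → m ^ n < i * a → + 1 ℚ./ a ℚ.< q
    1/a< {q} i n q≃ lt = Rep-<⁺ {+ 1 ℚ./ a} {q} 1 0 a i 0 (m ^ n) {{_}} {{m^n≢0 m n}} (Rep-/ 1 a) q≃
      (+-monoˡ-< 0 (subst (_< i * a) (sym (+-identityʳ (m ^ n))) lt))

    ≤1/a : ∀ {q} i n → OverPow q i n → i * a ≤ m ^ n → q ℚ.≤ + 1 ℚ./ a
    ≤1/a {q} i n q≃ le = Rep-≤⁺ {q} {+ 1 ℚ./ a} i 0 (m ^ n) 1 0 a {{m^n≢0 m n}} q≃ (Rep-/ 1 a)
      (+-monoˡ-≤ 0 (subst (i * a ≤_) (sym (+-identityʳ (m ^ n))) le))

    1/a≤ : ∀ {q} i n → OverPow q i n → m ^ n ≤ i * a → + 1 ℚ./ a ℚ.≤ q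
    1/a≤ {q} i n q≃ le = Rep-≤⁺ {+ 1 ℚ./ a} {q} 1 0 a i 0 (m ^ n) {{_}} {{m^n≢0 m n}} (Rep-/ 1 a) q≃
      (+-monoˡ-≤ 0 (subst (_≤ i * a) (sym (+-identityʳ (m ^ n))) le))

  -- 1/a lies in every closed interval [s_n , s_n + m^(-n)] over the partial sums s_n, with
  -- denominators cleared.
  Brackets : ℕ → Set
  Brackets a = ∀ n → numerator n * a ≤ m ^ n × m ^ n ≤ suc (numerator n) * a

  -- If 1/a lay outside the n-th interval, its distance to the nearer end would serve as ε; all
  -- later partial sums stay inside, which contradicts convergence.
  converges⇒brackets : ∀ a .{{_ : NonZero a}} → partialSum b ⟶ fromℚ (+ 1 ℚ./ a) → Brackets a
  converges⇒brackets a s⟶x n = ≮⇒≥ lower , ≮⇒≥ upper′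
    where
    x = + 1 ℚ./ a
    lower : ¬ (m ^ n < numerator n * a)
    lower lt = ℚ.<-irrefl refl (ℚ.<-≤-trans
      (subst (partialSum b (n₀ + n) ℚ.<_) (q+[p-q]≡p (partialSum b n) x)
        (p-q<r⇒p<r+q (partialSum b (n₀ + n)) _ x (fromℚ-<⁻ (proj₁ (proj₂ near (n₀ + n) (m≤m+n n₀ n))))))
      (partialSum-mono n₀ n))
      where
      x<sₙ : x ℚ.< partialSum b n
      x<sₙ = 1/a< a (numerator n) n (Rep-partialSum n) lt
      near = s⟶x (partialSum b n ℚ.- x) (p<q⇒0<q-p x<sₙ)
      n₀ = proj₁ near
    upper′ : ¬ (suc (numerator n) * a < m ^ n)
    upper′ lt = ℚ.<-irrefl refl (ℚ.<-≤-trans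
      (+-cancelʳ-<ℚ (x ℚ.- upper n) (subst (ℚ._< partialSum b (n₀ + n) ℚ.+ (x ℚ.- upper n))
        (sym (q+[p-q]≡p x (upper n))) (fromℚ-<⁻ (proj₂ (proj₂ near (n₀ + n) (m≤m+n n₀ n))))))
      (ℚ.≤-trans (partialSum≤upper (n₀ + n)) (upper-antitone n₀ n)))
      where
      u<x : upper n ℚ.< x
      u<x = <1/a a (suc (numerator n)) n (Rep-upper n) lt
      near = s⟶x (x ℚ.- upper n) (p<q⇒0<q-p u<x)
      n₀ = proj₁ near

  brackets⇒converges : ∀ a .{{_ : NonZero a}} → Brackets a → partialSum b ⟶ fromℚ (+ 1 ℚ./ a)
  -- From the denominator of ε on, n < m^n gives m^(-n) < 1/n ≤ ε, the numerator of ε being at least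
  -- 1.
  brackets⇒converges a br ε 0<ε = ↧ₙ ε , λ n d≤n →
      fromℚ-<⁺ (ℚ.<-≤-trans (p-q<p (partialSum b n) ε 0<ε) (lower n))
    , fromℚ-<⁺ (ℚ.≤-<-trans (upper′ n) (ℚ.+-monoʳ-< (partialSum b n) (small n d≤n)))
    where
    x = + 1 ℚ./ a
    lower : ∀ n → partialSum b n ℚ.≤ x
    lower n = ≤1/a a (numerator n) n (Rep-partialSum n) (proj₁ (br n))
    upper′ : ∀ n → x ℚ.≤ partialSum b n ℚ.+ 1/m^ n
    upper′ n = 1/a≤ a (numerator n + 1) n
      (OverPow-+ {partialSum b n} (numerator n) 1 n (Rep-partialSum n) (OverPow-/ 1 n))
      (subst (λ k → m ^ n ≤ k * a) (+-comm 1 (numerator n)) (proj₂ (br n)))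
    i = LogLemmas.pos (↥ ε)
    j = LogLemmas.neg (↥ ε)
    j<i : j < i
    j<i = subst₂ _<_ (*-identityʳ j) (trans (+-identityʳ _) (*-identityʳ i))
      (Rep-<⁻ {0ℚ} {ε} 0 0 1 i j (↧ₙ ε) (Rep-/ 0 1) (Rep-self ε) 0<ε)
    small : ∀ n → ↧ₙ ε ≤ n → 1/m^ n ℚ.< ε
    small n d≤n = Rep-<⁺ {1/m^ n} {ε} 1 0 (m ^ n) i j (↧ₙ ε) {{m^n≢0 m n}} (OverPow-/ 1 n) (Rep-self ε) (begin-strict
      1 * ↧ₙ ε + j * m ^ n      ≡⟨ cong (_+ j * m ^ n) (*-identityˡ (↧ₙ ε)) ⟩
      ↧ₙ ε + j * m ^ n          <⟨ +-monoˡ-< (j * m ^ n) (≤-<-trans d≤n (LogLemmas.n<b^n m m>1 n)) ⟩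
      suc j * m ^ n             ≤⟨ *-monoˡ-≤ (m ^ n) j<i ⟩
      i * m ^ n                 ≡⟨ sym (+-identityʳ _) ⟩
      i * m ^ n + 0 * ↧ₙ ε      ∎)
      where open ≤-Reasoning

-- Long division of 1 by a

Step : (m : ℕ) → Subset m → (a : ℕ) → ℕ → Fin m → ℕ → Set
Step m D a r d r′ = d Subset.∈ D × r′ ≤ a × m * r ≡ a * toℕ d + r′

-- Long division of 1 by a in base m with digits in D, where the remainder a
-- is admitted so as to cover expansions ending in the digit m - 1.
record Division (m : ℕ) (D : Subset m) (a : ℕ) : Set where
  field
    digit     : ℕ → Fin m
    remainder : ℕ → ℕ
    start     : remainder 0 ≡ 1
    step      : ∀ i → Step m D a (remainder i) (digit i) (remainder (suc i))

open Division

-- The i-th remainder is a m^i (1/a - s_i) with s_i the partial sum, and `Brackets` says that it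
-- lies in [0 , a].
K⇒Division : ∀ {m} → 1 < m → ∀ D a x → x ≈ᵣ 1/ a → K m D x → Division m D (value a)
K⇒Division {m} 1<m D a x x≈ (b , b∈D , s⟶x) = record
  { digit     = b
  ; remainder = r
  ; start     = refl
  ; step      = λ i → b∈D i
      , m≤n+o⇒m∸n≤o (m ^ suc i) (numerator (suc i) * value a)
          (subst (m ^ suc i ≤_) (+-comm (value a) _) (proj₂ (br (suc i))))
      , divide i
  }
  where
  open Expansion b 1<m
  instance a≢0 = value-nonZero a
  br : Brackets (value a)
  br = converges⇒brackets (value a) (⟶-resp-≈ (partialSum b) x (1/ a) x≈ s⟶x)
  r : ℕ → ℕ
  r i = m ^ i ∸ numerator i * value a
  divide : ∀ i → m * r i ≡ value a * toℕ (b i) + r (suc i)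
  divide i = begin
    m * (m ^ i ∸ s * A)                    ≡⟨ *-distribˡ-∸ m (m ^ i) (s * A) ⟩
    m ^ suc i ∸ m * (s * A)                ≡⟨ sym (m+[n∸m]≡n (m+n≤o⇒m≤o∸n (A * d) (subst (_≤ m ^ suc i) (+-comm (m * (s * A)) (A * d)) bound))) ⟩
    A * d + (m ^ suc i ∸ m * (s * A) ∸ A * d)  ≡⟨ cong (λ n → A * d + n) (trans (∸-+-assoc (m ^ suc i) (m * (s * A)) (A * d)) (cong (m ^ suc i ∸_) (ring m s A d))) ⟩
    A * d + r (suc i)                      ∎
    where
    open ≡-Reasoning
    s = numerator i
    A = value a
    d = toℕ (b i)
    ring : ∀ m s A d → m * (s * A) + A * d ≡ (m * s + d) * A
    ring = solve-∀
    bound : m * (s * A) + A * d ≤ m ^ suc i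
    bound = subst (_≤ m ^ suc i) (sym (ring m s A d)) (proj₁ (br (suc i)))

module DivisionInvariant {m : ℕ} (1<m : 1 < m) {D : Subset m} {a : ℕ} (δ : Division m D a) where
  open Expansion (digit δ) 1<m

  invariant : ∀ i → m ^ i ≡ numerator i * a + remainder δ i
  invariant zero    = sym (start δ)
  invariant (suc i) = begin
    m * m ^ i                                      ≡⟨ cong (m *_) (invariant i) ⟩
    m * (numerator i * a + remainder δ i)          ≡⟨ *-distribˡ-+ m _ _ ⟩
    m * (numerator i * a) + m * remainder δ i      ≡⟨ cong (λ n → m * (numerator i * a) + n) (proj₂ (proj₂ (step δ i))) ⟩
    m * (numerator i * a) + (a * toℕ (digit δ i) + remainder δ (suc i))
                                                   ≡⟨ ring m (numerator i) a (toℕ (digit δ i)) (remainder δ (suc i)) ⟩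
    numerator (suc i) * a + remainder δ (suc i)    ∎
    where
    open ≡-Reasoning
    ring : ∀ m s a d r → m * (s * a) + (a * d + r) ≡ (m * s + d) * a + r
    ring = solve-∀

  remainder≤ : 0 < a → ∀ i → remainder δ i ≤ a
  remainder≤ 0<a zero    = subst (_≤ a) (sym (start δ)) 0<a
  remainder≤ 0<a (suc i) = proj₁ (proj₂ (step δ i))

  brackets : 0 < a → Brackets a
  brackets 0<a i = subst (numerator i * a ≤_) (sym (invariant i)) (m≤m+n _ _)
    , subst₂ _≤_ (sym (invariant i)) (+-comm _ a) (+-monoʳ-≤ (numerator i * a) (remainder≤ 0<a i))

  module _ {p} (p-prime : Prime p) (p∤m : p ∤ m) (p∣a : p ∣ a) .{{_ : NonZero a}} where

    remainder< : ∀ i → remainder δ i < a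
    remainder< i = ≤∧≢⇒< (remainder≤ (>-nonZero⁻¹ a) i) λ r≡a → p∤m (prime-∣-^ p-prime i
      (subst (p ∣_) (sym (trans (invariant i) (cong (λ n → numerator i * a + n) r≡a)))
        (∣m∣n⇒∣m+n (∣n⇒∣m*n (numerator i) p∣a) p∣a)))

    remainder≡ : ∀ i → m ^ i % a ≡ remainder δ i
    remainder≡ i = trans (cong (_% a) (trans (invariant i) (+-comm _ (remainder δ i))))
      (trans ([m+kn]%n≡m%n (remainder δ i) (numerator i) a) (m<n⇒m%n≡m (remainder< i)))

    isDigit : ∀ i → IsDigit a (m * remainder δ i) (toℕ (digit δ i))
    isDigit i =
        subst₂ _≤_ (*-comm a d) (sym (proj₂ (proj₂ (step δ i)))) (m≤m+n _ _)
      , subst₂ _<_ (sym (proj₂ (proj₂ (step δ i)))) (trans (+-comm (a * d) a) (cong (λ n → a + n) (*-comm a d)))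
          (+-monoʳ-< (a * d) (remainder< (suc i)))
      where d = toℕ (digit δ i)

Division⇒K : ∀ {m} → 1 < m → ∀ D a → Division m D (value a) → K m D (1/ a)
Division⇒K 1<m D a δ = digit δ , (λ i → proj₁ (step δ i))
  , Expansion.brackets⇒converges (digit δ) 1<m (value a) (DivisionInvariant.brackets 1<m δ (>-nonZero⁻¹ (value a)))
  where instance a≢0 = value-nonZero a

-- Deciding whether 1/a lies in K

module Decide (m : ℕ) (1<m : 1 < m) (D : Subset m) (a : ℕ) .{{_ : NonZero a}} where

  -- A digit determines the next remainder, so a search over digits alone decides whether n steps
  -- are possible from r.
  Path : ℕ → ℕ → Set
  Path zero    r = ⊤
  Path (suc n) r = ∃[ d ] (d Subset.∈ D × a * toℕ d ≤ m * r × m * r ∸ a * toℕ d ≤ a × Path n (m * r ∸ a * toℕ d))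

  path? : ∀ n r → Dec (Path n r)
  path? zero    r = yes tt
  path? (suc n) r = Fin.any? λ d → (d ∈? D) ×-dec (a * toℕ d ≤? m * r)
    ×-dec (m * r ∸ a * toℕ d ≤? a) ×-dec path? n (m * r ∸ a * toℕ d)

  Division⇒Path : (δ : Division m D a) → ∀ n i → Path n (remainder δ i)
  Division⇒Path δ zero    i = tt
  Division⇒Path δ (suc n) i with step δ i
  ... | d∈D , r′≤a , eq = digit δ i , d∈D , subst (a * toℕ (digit δ i) ≤_) (sym eq) (m≤m+n _ _)
    , subst (_≤ a) (sym next) r′≤a , subst (Path n) (sym next) (Division⇒Path δ n (suc i))
    where
    next : m * remainder δ i ∸ a * toℕ (digit δ i) ≡ remainder δ (suc i)
    next = trans (cong (_∸ a * toℕ (digit δ i)) eq) (m+n∸m≡n (a * toℕ (digit δ i)) _)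

  Segment : ℕ → ℕ → Set
  Segment n r = Σ[ dig ∈ (ℕ → Fin m) ] Σ[ st ∈ (ℕ → ℕ) ]
    (st 0 ≡ r × (∀ i → i < n → Step m D a (st i) (dig i) (st (suc i))))

  Path⇒Segment : ∀ n r → Path n r → Segment n r
  Path⇒Segment zero    r _ = (λ _ → fromℕ< {0} (<-trans (s≤s z≤n) 1<m)) , (λ _ → r) , refl , λ _ ()
  Path⇒Segment (suc n) r (d , d∈D , ad≤ , r′≤a , path) with Path⇒Segment n (m * r ∸ a * toℕ d) path
  ... | dig , st , st0 , steps = dig′ , st′ , refl , steps′
    where
    dig′ : ℕ → Fin m
    dig′ zero    = d
    dig′ (suc i) = dig i
    st′ : ℕ → ℕ
    st′ zero    = r
    st′ (suc i) = st i
    steps′ : ∀ i → i < suc n → Step m D a (st′ i) (dig′ i) (st′ (suc i))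
    steps′ zero    _         = d∈D , subst (_≤ a) (sym st0) r′≤a
      , trans (sym (m+[n∸m]≡n ad≤)) (cong (λ n → a * toℕ d + n) (sym st0))
    steps′ (suc i) (s≤s i<n) = steps i i<n

  -- A segment of length a + 1 passes through a + 2 remainders in [0 , a], so
  -- it can be closed up to a loop.
  Segment⇒Division : Segment (suc a) 1 → Division m D a
  Segment⇒Division (dig , st , st0 , steps)
    with Fin.pigeonhole (n<1+n (suc a)) (λ i → fromℕ< (s≤s (st≤ (toℕ i) (s≤s⁻¹ (Fin.toℕ<n i)))))
    where
    st≤ : ∀ i → i ≤ suc a → st i ≤ a
    st≤ zero    _   = subst (_≤ a) (sym st0) (>-nonZero⁻¹ a)
    st≤ (suc i) i<n = proj₁ (proj₂ (steps i i<n))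
  ... | i′ , j′ , i<j , eq = record
    { digit     = λ n → dig (idx n)
    ; remainder = λ n → st (idx n)
    ; start     = st0
    ; step      = λ n → subst (Step m D a (st (idx n)) (dig (idx n))) (sym (st-next (idx n)))
        (steps (idx n) (<-≤-trans (idx<j n) (s≤s⁻¹ (Fin.toℕ<n j′))))
    }
    where
    i = toℕ i′
    j = toℕ j′
    st≡ : st i ≡ st j
    st≡ = trans (sym (Fin.toℕ-fromℕ< _)) (trans (cong toℕ eq) (Fin.toℕ-fromℕ< _))
    -- Index j is replaced by i, which carries the same remainder. Indices thus stay below j ≤ a +
    -- 1, where `steps` applies.
    next : ℕ → ℕ
    next k with suc k ≟ j
    ... | yes _ = i
    ... | no  _ = suc k
    st-next : ∀ k → st (next k) ≡ st (suc k)
    st-next k with suc k ≟ j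
    ... | yes 1+k≡j = trans st≡ (cong st (sym 1+k≡j))
    ... | no  _     = refl
    next<j : ∀ k → k < j → next k < j
    next<j k k<j with suc k ≟ j
    ... | yes _ = i<j
    ... | no 1+k≢j = ≤∧≢⇒< k<j 1+k≢j
    idx : ℕ → ℕ
    idx zero    = 0
    idx (suc n) = next (idx n)
    idx<j : ∀ n → idx n < j
    idx<j zero    = ≤-<-trans z≤n i<j
    idx<j (suc n) = next<j (idx n) (idx<j n)

  division? : Dec (Division m D a)
  division? = map′ (λ path → Segment⇒Division (Path⇒Segment (suc a) 1 path))
    (λ δ → subst (Path (suc a)) (start δ) (Division⇒Path δ (suc a) 0)) (path? (suc a) 1)

-- The logarithmic hypothesis

≤-*-⊓ : ∀ {x} u p q → x ℚ.≤ u ℚ.* p → x ℚ.≤ u ℚ.* q → x ℚ.≤ u ℚ.* (p ℚ.⊓ q)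
≤-*-⊓ {x} u p q x≤up x≤uq with ℚ.⊓-sel p q
... | inj₁ eq = subst (λ r → x ℚ.≤ u ℚ.* r) (sym eq) x≤up
... | inj₂ eq = subst (λ r → x ℚ.≤ u ℚ.* r) (sym eq) x≤uq

-- Both branches of the minimum reach 2 #D: the first by #D ≤ m - 1, the second because (m - 1)/(m -
-- #D) ≥ 1.
2D≤c : ∀ m (D : Subset m) (#D<m : ∣ D ∣ < m) → 0 < ∣ D ∣ → + (2 * ∣ D ∣) ℚ./ 1 ℚ.≤ c m D #D<m
2D≤c m D #D<m 0<#D = ≤-*-⊓ u 1ℚ r
  (Rep-≤⁺ {+ (2 * #D) ℚ./ 1} {u ℚ.* 1ℚ} (2 * #D) 0 1 (2 * (m ∸ 1) * 1) 0 1
    (Rep-/ (2 * #D) 1) (Rep-* {u} {1ℚ} (2 * (m ∸ 1)) 1 1 1 (Rep-/ (2 * (m ∸ 1)) 1) (Rep-/ 1 1))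
    (+-monoˡ-≤ 0 (*-monoˡ-≤ 1 (subst (2 * #D ≤_) (sym (*-identityʳ (2 * (m ∸ 1)))) (*-monoʳ-≤ 2 (∸-monoˡ-≤ 1 #D<m))))))
  (Rep-≤⁺ {+ (2 * #D) ℚ./ 1} {u ℚ.* r} (2 * #D) 0 1 (2 * (m ∸ 1) * #D) 0 (1 * (m ∸ #D))
    (Rep-/ (2 * #D) 1) (Rep-* {u} {r} (2 * (m ∸ 1)) 1 #D (m ∸ #D) (Rep-/ (2 * (m ∸ 1)) 1) (Rep-/ #D (m ∸ #D)))
    (+-monoˡ-≤ 0 (subst₂ _≤_ (ring₁ #D (m ∸ #D)) (ring₂ #D (m ∸ 1)) (*-monoʳ-≤ (2 * #D) (∸-monoʳ-≤ m 0<#D)))))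
  where
  #D = ∣ D ∣
  instance
    m∸D≢0 : NonZero (m ∸ #D)
    m∸D≢0 = >-nonZero (m<n⇒0<n∸m #D<m)
    1*[m∸D]≢0 : NonZero (1 * (m ∸ #D))
    1*[m∸D]≢0 = m*n≢0 1 (m ∸ #D)
  u r : ℚ
  u = + (2 * (m ∸ 1)) ℚ./ 1
  r = + #D ℚ./ (m ∸ #D)
  ring₁ : ∀ d k → 2 * d * k ≡ 2 * d * (1 * k)
  ring₁ = solve-∀
  ring₂ : ∀ d k → 2 * d * k ≡ 2 * k * d * 1
  ring₂ = solve-∀

-- The strict inequality yields rationals above t, γ and log c whose sum lies below α ≤ e. Hence e -
-- (t + f), possibly negative a priori, is in the upper cut of log c; clearing denominators in c =
-- x/y and using k ≤ c gives the bound on powers.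
log-bound : ∀ b .{{_ : NonTrivial b}} (c : ℚ) .{{_ : ℚ.Positive c}} (α γ : ℝ) t f e k →
  α ≤ᵣ fromℕ e → fromℕ f ≤ᵣ γ → fromℕ t +ᵣ γ +ᵣ log b c <ᵣ α → + k ℚ./ 1 ℚ.≤ c →
  b ^ (t + f) * k < b ^ e
log-bound b c α γ t f e k α≤e f≤γ (_ , (_ , q₃ , (q₁ , q₂ , t<q₁ , γ<q₂ , refl) , log<q₃ , refl) , <α) k≤c =
  *-cancelˡ-< y _ _ (begin-strict
    y * (b ^ (t + f) * k)    ≡⟨ ring y (b ^ (t + f)) k ⟩
    b ^ (t + f) * (k * y)    ≤⟨ *-monoʳ-≤ (b ^ (t + f)) ky≤x ⟩
    b ^ (t + f) * x          ≡⟨ cong (b ^ (t + f) *_) (sym (*-identityʳ x)) ⟩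
    b ^ (t + f) * x ^ 1      <⟨ below ⟩
    y ^ 1 * b ^ e            ≡⟨ cong (_* b ^ e) (*-identityʳ y) ⟩
    y * b ^ e                ∎)
  where
  open LogCut b c using (x; y; b≢0; Rep-c; Hi⇒; Hi-up-≤)
  open ≤-Reasoning
  ring : ∀ y p k → y * (p * k) ≡ p * (k * y)
  ring = solve-∀
  r = frac e (t + f) 1
  f≤q₂ : + f ℚ./ 1 ℚ.≤ q₂
  f≤q₂ = ℚ.≮⇒≥ λ q₂<f → ℚ.<-irrefl refl (L<U γ (f≤γ q₂ q₂<f) γ<q₂)
  q₃≤r : q₃ ℚ.≤ r
  q₃≤r = ℚ.≮⇒≥ λ r<q₃ → <-irrefl (ring′ e (t + f))
    (Rep-<⁻ {((+ t ℚ./ 1) ℚ.+ (+ f ℚ./ 1)) ℚ.+ r} {+ e ℚ./ 1} (t + f + e) (t + f) 1 e 0 1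
      (Rep-+ {(+ t ℚ./ 1) ℚ.+ (+ f ℚ./ 1)} {r} (t + f) 0 1 e (t + f)
        (Rep-+ {+ t ℚ./ 1} {+ f ℚ./ 1} t 0 1 f 0 (Rep-/ t 1) (Rep-/ f 1)) (Rep-frac e (t + f) 1))
      (Rep-/ e 1)
      (ℚ.<-trans (ℚ.+-mono-< (ℚ.+-mono-<-≤ t<q₁ f≤q₂) r<q₃) (α≤e _ <α)))
    where
    ring′ : ∀ e s → (s + e) * 1 + 0 * 1 ≡ e * 1 + s * 1
    ring′ = solve-∀
  -- The cut speaks of the reduced fraction of r; monotonicity of `Below` passes to the exponents t
  -- + f and e over 1.
  below : Below b y x (t + f) e 1
  below = Below-down b y x (LogLemmas.neg (↥ r)) (LogLemmas.pos (↥ r)) (↧ₙ r) (t + f) e 1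
    (subst₂ _≤_ (+-comm (LogLemmas.pos (↥ r) * 1) _) (+-comm (e * ↧ₙ r) _)
      (Rep-≤⁻ {r} {r} _ _ _ e (t + f) 1 (Rep-self r) (Rep-frac e (t + f) 1) ℚ.≤-refl))
    (Hi⇒ r (Hi-up-≤ {q₃} {r} q₃≤r log<q₃))
  ky≤x : k * y ≤ x
  ky≤x = subst₂ _≤_ (+-identityʳ (k * y)) (trans (+-identityʳ (x * 1)) (*-identityʳ x))
    (Rep-≤⁻ {+ k ℚ./ 1} {c} k 0 1 x 0 y (Rep-/ k 1) Rep-c k≤c)

-- At p = 2 lifting the exponent needs 4 ∣ x - 1, which m itself may fail; hence the base m².
four∣m²∸1 : ∀ m → 2 ∤ m → 2 * 2 ∣ m ^ 2 ∸ 1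
four∣m²∸1 m 2∤m with m % 2 | m≡m%n+[m/n]*n m 2 | m%n<n m 2
... | 0           | eq | _ = contradiction (subst (2 ∣_) (sym eq) (n∣m*n (m / 2))) 2∤m
... | 1           | eq | _ = subst (λ n → 4 ∣ n ^ 2 ∸ 1) (sym eq)
  (divides (m / 2 * (m / 2) + m / 2) (cong (_∸ 1) (ring (m / 2))))
  where
  ring : ∀ r → (1 + r * 2) * ((1 + r * 2) * 1) ≡ suc ((r * r + r) * 4)
  ring = solve-∀
... | suc (suc _) | _  | s≤s (s≤s ())

t-odd : ∀ m p → p ≢ 2 → t m p ≡ ν p (m ^ ord p m ∸ 1)
t-odd m p p≢2 with p ≟ 2
... | yes p≡2 = contradiction p≡2 p≢2
... | no  _   = refl

t-two : ∀ m p → p ≡ 2 → t m p ≡ ν p (m ^ 2 ∸ 1) ∸ 1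
t-two m p refl = refl

-- As n ≥ 1, the exponent e exceeds s. The surplus is written `suc k` because for p = 2 one factor
-- moves into τ.
pow-excess : ∀ p s e n .{{_ : NonZero p}} .{{_ : NonZero n}} → p ^ s * n < p ^ e →
  ∃[ k ] (e ≡ s + suc k × n < p ^ suc k)
pow-excess p s e n lt = k , e≡ , *-cancelˡ-< (p ^ s) n (p ^ suc k)
  (subst (p ^ s * n <_) (trans (cong (p ^_) e≡) (^-distribˡ-+-* p s (suc k))) lt)
  where
  s<e : s < e
  s<e = ≰⇒> λ e≤s → <⇒≱ lt (≤-trans (^-monoʳ-≤ p e≤s) (m≤m*n (p ^ s) n))
  k = e ∸ suc s
  e≡ : e ≡ s + suc k
  e≡ = sym (trans (+-suc s k) (m+[n∸m]≡n s<e))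

-- The orbit against the number of digits

module _ (m : ℕ) (3≤m : 3 ≤ m) (D : Subset m) (0<#D : 0 < ∣ D ∣) (#D<m : ∣ D ∣ < m)
  (a : ℕ⁺) (p : ℕ) (p-prime : Prime p) (p∤m : p ∤ m) where

  private
    1<m : 1 < m
    1<m = <-trans (s≤s (s≤s z≤n)) 3≤m
    q = Q m a
    ℓ = ord (rad q) m
    e = ν p q
    f = ν p ℓ
    instance
      m≢0 : NonZero m
      m≢0 = >-nonZero (<-trans (s≤s z≤n) 1<m)
      a≢0 : NonZero (value a)
      a≢0 = value-nonZero a
      q≢0 : NonZero q
      q≢0 = Q-nonZero m a
      A≢0 : NonZero (mPart m (value a))
      A≢0 = mPart≢0 m (value a)

  -- The powers of m modulo a are the remainders of the division, so all points of the progression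
  -- have their leading digit in D; the alternative m ≤ #D is excluded.
  few-digits : ∀ {N W x} .{{_ : NonZero W}} .{{_ : NonZero (N * W)}} → N * W ≡ value a → p ∣ value a →
    x < W → (∀ j → j < N → ∃[ n ] m ^ n % (N * W) ≡ x + j * W) → Division m D (value a) → N ≤ ∣ D ∣
  few-digits {N} {W} {x} N*W≡a p∣a x<W orbit δ = [ id , (λ m≤#D → contradiction m≤#D (<⇒≱ #D<m)) ]′
    (spaced-digits D x<W λ j j<N → digits j (orbit j j<N))
    where
    δ′ : Division m D (N * W)
    δ′ = subst (Division m D) (sym N*W≡a) δ
    open DivisionInvariant 1<m δ′
    p∣NW : p ∣ N * W
    p∣NW = subst (p ∣_) (sym N*W≡a) p∣a
    digits : ∀ j → ∃[ n ] m ^ n % (N * W) ≡ x + j * W →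
      ∃[ d ] (d Subset.∈ D × IsDigit (N * W) (m * (x + j * W)) (toℕ d))
    digits j (n , eq) = Division.digit δ′ n , proj₁ (Division.step δ′ n)
      , subst (λ r → IsDigit (N * W) (m * r) (toℕ (Division.digit δ′ n)))
          (trans (sym (remainder≡ p-prime p∤m p∣NW n)) eq) (isDigit p-prime p∤m p∣NW n)

  no-division : ∀ z o τ k → m ^ o ≡ suc z → p ∣ z → p * p ∣ z * tri p → p ^ τ ∣ z →
    (∀ i → p ^ i ∣ z → i ≤ τ) → e ≡ τ + f + k → 0 < e → ∣ D ∣ < p ^ k → ¬ Division m D (value a)
  no-division z o τ k m^o≡ p∣z p²∣ p^τ∣z τ-max e≡ 0<e #D<N δ =
    conclude (ν-cofactor p-prime q) (ν-cofactor p-prime ℓ {{proj₁ ℓ-spec}}) (mPart-∣-power m (value a))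
    where
    ℓ-spec : NonZero ℓ × rad q ∣ m ^ ℓ ∸ 1
    ℓ-spec = ord-spec (rad q) m {{rad-nonZero q}} (rad-coprime q (Q-disjoint m a))
    p∣a : p ∣ value a
    p∣a = subst (p ∣_) (mPart*Q m a) (∣n⇒∣m*n (mPart m (value a))
      (∣-trans (subst (_∣ p ^ e) (*-identityʳ p) (^-monoʳ-∣ p 0<e)) (ν-∣ p q)))
    conclude : ∃[ q′ ] (q ≡ q′ * p ^ e × p ∤ q′) → ∃[ u ] (ℓ ≡ u * p ^ f × p ∤ u) →
      ∃[ h ] mPart m (value a) ∣ m ^ h → _
    conclude (q′ , q≡ , p∤q′) (u , ℓ≡ , p∤u) (h , A∣m^h) =
      <⇒≱ #D<N (few-digits {N} {W} {g 0 % W} N*W≡a p∣a (m%n<n (g 0) W) orbit δ)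
      where
      instance
        q′≢0 : NonZero q′
        q′≢0 = ≢-nonZero λ q′≡0 → ≢-nonZero⁻¹ q (trans q≡ (cong (_* p ^ e) q′≡0))
      open Orbit m p-prime p∤m z o τ m^o≡ p∣z p²∣ p^τ∣z τ-max (mPart m (value a)) h q′ u f k A∣m^h p∤q′ p∤u
        -- A prime of q′ divides Q, hence rad Q, hence m^ℓ - 1 by definition of the order ℓ.
        (λ r r-prime r∣q′ → ∣-trans (∣rad q r-prime (subst (r ∣_) (sym q≡) (∣m⇒∣m*n (p ^ e) r∣q′)))
          (subst (λ l → rad q ∣ m ^ l ∸ 1) ℓ≡ (proj₂ ℓ-spec)))
      N*W≡a : N * W ≡ value a
      N*W≡a = trans (ring N (mPart m (value a)) q′ (p ^ (τ + f)))
        (trans (cong (λ x → mPart m (value a) * (q′ * x)) (trans (sym (^-distribˡ-+-* p (τ + f) k)) (cong (p ^_) (sym e≡))))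
        (trans (cong (mPart m (value a) *_) (sym q≡)) (mPart*Q m a)))
        where
        ring : ∀ N A q e → N * (A * (q * e)) ≡ A * (q * (e * N))
        ring = solve-∀

  suc-pred-pow : ∀ o → m ^ o ≡ suc (m ^ o ∸ 1)
  suc-pred-pow o = sym (m+[n∸m]≡n (>-nonZero⁻¹ (m ^ o) {{m^n≢0 m o}}))

  pow∸1-nonZero : ∀ o .{{_ : NonZero o}} → NonZero (m ^ o ∸ 1)
  pow∸1-nonZero o@(suc o′) = >-nonZero (m<n⇒0<n∸m (<-≤-trans 1<m (m≤m*n m (m ^ o′) {{m^n≢0 m o′}})))

  digits-obstruct : p ^ (t m p + f) * (2 * ∣ D ∣) < p ^ e → ¬ Division m D (value a)
  digits-obstruct bound = by-parity (p ≟ 2) (pow-excess p (t m p + f) e (2 * ∣ D ∣) bound)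
    where
    instance
      p≢0 : NonZero p
      p≢0 = prime⇒nonZero p-prime
      2#D≢0 : NonZero (2 * ∣ D ∣)
      2#D≢0 = m*n≢0 2 ∣ D ∣ {{_}} {{>-nonZero 0<#D}}

    by-parity : Dec (p ≡ 2) → ∃[ k ] (e ≡ t m p + f + suc k × 2 * ∣ D ∣ < p ^ suc k) → ¬ Division m D (value a)
    -- For odd p the valuation of m^ord_p(m) - 1 is t itself, so the whole surplus p^(k+1) > 2 #D
    -- serves as N.
    by-parity (no p≢2) (k , e≡ , 2#D<) = no-division z (ord p m) (t m p) (suc k) (suc-pred-pow (ord p m)) p∣z
      (*-pres-∣ p∣z (odd-prime∣tri p-prime p≢2)) (subst (λ τ → p ^ τ ∣ z) (sym t≡ν) (ν-∣ p z))
      (λ i p^i∣z → subst (i ≤_) (sym t≡ν) (ν-max i (prime>1 p-prime) p^i∣z))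
      e≡ (subst (0 <_) (sym (trans e≡ (+-suc (t m p + f) k))) (s≤s z≤n)) (≤-<-trans (m≤n*m ∣ D ∣ 2) 2#D<)
      where
      ord-ok = ord-spec p m (prime-coprime p-prime p∤m)
      z = m ^ ord p m ∸ 1
      instance
        z≢0 : NonZero z
        z≢0 = pow∸1-nonZero (ord p m) {{proj₁ ord-ok}}
      p∣z : p ∣ z
      p∣z = proj₂ ord-ok
      t≡ν : t m p ≡ ν p z
      t≡ν = t-odd m p p≢2
    -- The subgroup generated by m² has valuation t + 1; the factor 2 in 2 #D
    -- makes up for the extra 1.
    by-parity (yes p≡2) (k , e≡ , 2#D<) = no-division z 2 (suc (t m p)) k (suc-pred-pow 2)
      (subst (_∣ z) (sym p≡2) (∣-trans (divides 2 refl) 4∣z))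
      (subst (λ r → r * r ∣ z * tri r) (sym p≡2) (subst (4 ∣_) (sym (*-identityʳ z)) 4∣z))
      (subst (λ τ → p ^ τ ∣ z) ν≡1+t (ν-∣ p z))
      (λ i p^i∣z → subst (i ≤_) ν≡1+t (ν-max i (prime>1 p-prime) p^i∣z))
      (trans e≡ (+-suc (t m p + f) k)) (subst (0 <_) (sym (trans e≡ (+-suc (t m p + f) k))) (s≤s z≤n))
      (*-cancelˡ-< 2 ∣ D ∣ (p ^ k) (subst (λ r → 2 * ∣ D ∣ < r * p ^ k) p≡2 2#D<))
      where
      z = m ^ 2 ∸ 1
      instance
        z≢0 : NonZero z
        z≢0 = pow∸1-nonZero 2
      4∣z : 4 ∣ z
      4∣z = four∣m²∸1 m (subst (_∤ m) p≡2 p∤m)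
      ν≡1+t : ν p z ≡ suc (t m p)
      ν≡1+t = sym (trans (cong suc (t-two m p p≡2)) (m+[n∸m]≡n (≤-trans (s≤s z≤n)
        (ν-max {p} {z} 2 (prime>1 p-prime) (subst (λ r → r ^ 2 ∣ z) (sym p≡2) 4∣z)))))

-- Finiteness of the intersection

K-resp-≈ : ∀ {m D} x y → x ≈ᵣ y → K m D x → K m D y
K-resp-≈ x y x≈y (b , b∈D , s⟶x) = b , b∈D , ⟶-resp-≈ (partialSum b) x y x≈y s⟶x

module _ {m : ℕ} (1<m : 1 < m) (D : Subset m) (a : ℕ⁺ → ℕ⁺) where

  -- Every listed real must itself belong to the intersection, so the indices before n₀ are filtered
  -- by the decision procedure for divisions; `beyond` excludes all others.
  finite-intersection : ∀ n₀ → (∀ n → n₀ ≤⁺ n → 1/ a n ∉ K m D) → Finite (reciprocals a ∩ K m D)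
  finite-intersection n₀ beyond = map (λ n → 1/ a n) hits , λ x → mk⇔ (to x) (from x)
    where
    divides? : ∀ n → Dec (Division m D (value (a n)))
    divides? n = Decide.division? m 1<m D (value (a n)) {{value-nonZero (a n)}}
    below : List ℕ⁺
    below = map (λ k → mkℕ⁺ (suc k)) (upTo (value n₀))
    hits : List ℕ⁺
    hits = filter divides? below
    ∈-below : ∀ n → value n < value n₀ → n ∈ below
    ∈-below (mkℕ⁺ (suc k)) n<n₀ = ∈-map⁺ (λ k → mkℕ⁺ (suc k)) (∈-upTo⁺ (<-trans (n<1+n k) n<n₀))
    to : ∀ x → (reciprocals a ∩ K m D) x → Any (x ≈ᵣ_) (map (λ n → 1/ a n) hits)
    to x ((n , x≈) , x∈K) = by-size (value n <? value n₀)
      where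
      δ : Division m D (value (a n))
      δ = K⇒Division 1<m D (a n) x x≈ x∈K
      by-size : Dec (value n < value n₀) → Any (x ≈ᵣ_) (map (λ n → 1/ a n) hits)
      by-size (yes n<n₀) = Any.map⁺ (lose (∈-filter⁺ divides? (∈-below n n<n₀) δ) x≈)
      by-size (no n≮n₀)  = contradiction (Division⇒K 1<m D (a n) δ) (beyond n (≮⇒≥ n≮n₀))
    from : ∀ x → Any (x ≈ᵣ_) (map (λ n → 1/ a n) hits) → (reciprocals a ∩ K m D) x
    from x any = recover (find (Any.map⁻ any))
      where
      recover : ∃[ n ] (n ∈ hits × x ≈ᵣ 1/ a n) → (reciprocals a ∩ K m D) x
      recover (n , n∈hits , x≈) = (n , x≈) , K-resp-≈ {D = D} (1/ a n) x (proj₂ x≈ , proj₁ x≈)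
        (Division⇒K 1<m D (a n) (proj₂ (∈-filter⁻ divides? {xs = below} n∈hits)))

theorem3p5 : (m : ℕ) → 3 ≤ m →
    (D : Subset m) (1<#D : 1 < ∣ D ∣) (#D<m : ∣ D ∣ < m) →
    (a : ℕ⁺ → ℕ⁺) →
    (p₀ : ℕ) (p₀-prime : Prime p₀) → p₀ ∤ m →
    (α γ : ℕ⁺ → ℝ) (N : ℕ⁺) →
    (∀ n → N ≤⁺ n →
    α n ≤ᵣ fromℕ (ν p₀ (Q m (a n))) ×
    fromℕ (ν p₀ (ord (rad (Q m (a n))) m)) ≤ᵣ γ n) →
    (n₀ : ℕ⁺) → N ≤⁺ n₀ →
    (∀ n → n₀ ≤⁺ n →
    fromℕ (t m p₀) +ᵣ γ n
    +ᵣ log p₀ {{prime⇒nonTrivial p₀-prime}} (c m D #D<m) {{c-positive m D 1<#D #D<m}}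
    <ᵣ α n) →
    (∀ n → n₀ ≤⁺ n → 1/ a n ∉ K m D) × Finite (reciprocals a ∩ K m D)
theorem3p5 m 3≤m D 1<#D #D<m a p₀ p₀-prime p₀∤m α γ N bounds n₀ N≤n₀ gap =
  beyond , finite-intersection 1<m D a n₀ beyond
  where
  1<m : 1 < m
  1<m = <-trans 1<#D #D<m
  0<#D : 0 < ∣ D ∣
  0<#D = <-trans (s≤s z≤n) 1<#D
  beyond : ∀ n → n₀ ≤⁺ n → 1/ a n ∉ K m D
  beyond n n₀≤n 1/a∈K = digits-obstruct m 3≤m D 0<#D #D<m (a n) p₀ p₀-prime p₀∤m
    (log-bound p₀ {{prime⇒nonTrivial p₀-prime}} (c m D #D<m) {{c-positive m D 1<#D #D<m}}
      (α n) (γ n) (t m p₀) (ν p₀ (ord (rad (Q m (a n))) m)) (ν p₀ (Q m (a n))) (2 * ∣ D ∣)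
      (proj₁ (bounds n (≤-trans N≤n₀ n₀≤n))) (proj₂ (bounds n (≤-trans N≤n₀ n₀≤n))) (gap n n₀≤n)
      (2D≤c m D #D<m 0<#D))
    (K⇒Division 1<m D (a n) (1/ a n) ((λ _ → id) , (λ _ → id)) 1/a∈K)
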